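{- There is a parameter-preserving reduction from Pathwidth One Vertex Explosion (POVE) to Co-Path Packing (CPP). Additionally, there is a parameter-preserving reduction from restricted POVE to restricted CPP. In all four problems the parameter is $k$.
   Context: Graphs are finite, undirected and simple. Vertex explosion: exploding a vertex $v$ of a graph removes $v$ and, for each former neighbor $u$ of $v$, adds a new vertex adjacent only to $u$. Exploding every vertex of a set $S$ means exploding the vertices of $S$ one after another (the order does not matter up to isomorphism). A path decomposition of $G$ is a sequence $X_1,\ldots,X_s$ of vertex sets such that every vertex lies in some $X_i$, both endpoints of every edge lie in some common $X_i$, and $X_i\cap X_j\subseteq X_l$ for all $i\le l\le j$; its width is $\max_i|X_i|-1$, and the pathwidth of $G$ is the minimum width of a path decomposition of $G$. A graph is a linear forest if every connected component is a path (a single vertex is a path). POVE: the input is a graph $G$ and an integer $k\ge 0$; the question is whether there is $S\subseteq V(G)$ with $|S|\le k$ such that exploding every vertex in $S$ results in a graph with pathwidth at most one. Restricted POVE: the input additionally contains a set $X\subseteq V(G)$, and $S$ is required to be a subset of $X$. CPP: the input is a graph $G$ and an integer $k\ge 0$; the question is whether there is $S\subseteq V(G)$ with $|S|\le k$ such that deleting the vertices in $S$ results in a linear forest. Restricted CPP: the input additionally contains a set $X\subseteq V(G)$, and $S$ is required to be a subset of $X$. A parameter-preserving reduction from a parameterized problem $P$ to a parameterized problem $Q$ is a polynomial-time algorithm that maps each instance $(I,k)$ of $P$ to an instance $(I',k')$ of $Q$ such that $k'\le k$ and $(I,k)$ is a yes-instance of $P$ if and only if $(I',k')$ is a yes-instance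 of $Q$. -}

module Defs where

open import Data.Bool.Base using (Bool; true; false; if_then_else_)
open import Data.Empty using (⊥)
open import Data.Fin.Base as Fin using (Fin; zero; suc; toℕ; splitAt)
import Data.Fin.Properties as Fin
open import Data.Fin.Subset as Subset using (Subset; _∈_; _⊆_; _∩_; _-_; ∣_∣; ∁; ⊤; Empty)
open import Data.Fin.Subset.Properties using (_∈?_)
open import Data.Digit using (toDigits)
import Data.Integer.Base as ℤ
open ℤ using (ℤ; +_; _⊖_)
open import Data.List.Base as List using (List; []; _∷_; _++_; allFin; concatMap; filter; length; map)
open import Data.List.Extrema.Nat using (max)
open import Data.Maybe.Base using (Maybe)
open import Data.Nat.Base using (ℕ; zero; suc; _+_; _*_; _^_; _≤_)
import Data.Nat.Properties as ℕ
open import Data.Product.Base using (∃-syntax; Σ-syntax; _×_; _,_; proj₁)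
open import Data.Sum.Base using (_⊎_; inj₁; inj₂; swap)
open import Data.Vec.Base as Vec using (Vec; _[_]%=_; tabulate; replicate)
open import Function.Bundles using (_⇔_; _↔_; module Inverse)
open import Level using (Level; 0ℓ; _⊔_)
open import Relation.Binary.Core using (Rel)
open import Relation.Binary.Definitions using (Symmetric; Irreflexive; Decidable)
open import Relation.Binary.Construct.Closure.ReflexiveTransitive using (Star)
open import Relation.Binary.PropositionalEquality using (_≡_; refl; sym; cong)
open import Relation.Nullary.Decidable using (does; no; _⊎-dec_)

private
  variable
    m n r t t₁ t₂ : ℕ

------------------------------------------------------------------------
-- Finite simple graphs

record Graph (n : ℕ) : Set₁ where
  infix 4 _~_ _~?_
  field
    _~_      : Rel (Fin n) 0ℓ
    _~?_     : Decidable _~_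
    ~-sym    : Symmetric _~_
    ~-irrefl : Irreflexive _≡_ _~_

  neighbours : Fin n → Subset n
  neighbours v = tabulate (λ u → does (v ~? u))

infix 4 _≅_

_≅_ : Graph m → Graph n → Set
_≅_ {m} {n} G H = Σ[ f ∈ Fin m ↔ Fin n ] ∀ u v →
    Graph._~_ G u v ⇔ Graph._~_ H (Inverse.to f u) (Inverse.to f v)

-- Subsets are turned into initial segments of ℕ by listing their elements in
-- increasing order.

elements : Subset n → List (Fin n)
elements p = filter (_∈? p) (allFin _)

order : Subset n → ℕ
order p = length (elements p)

nth : (p : Subset n) → Fin (order p) → Fin n
nth p = List.lookup (elements p)

infix 8 _[_]

_[_] : Graph n → (p : Subset n) → Graph (order p)
G [ p ] = record
  { _~_      = λ i j → nth p i ~ nth p j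
  ; _~?_     = λ i j → nth p i ~? nth p j
  ; ~-sym    = ~-sym
  ; ~-irrefl = λ i≡j → ~-irrefl (cong (nth p) i≡j)
  }
  where open Graph G

delete : Graph n → (S : Subset n) → Graph (order (∁ S))
delete G S = G [ ∁ S ]

------------------------------------------------------------------------
-- Linear forests

Consecutive : Rel (Fin n) 0ℓ
Consecutive i j = toℕ j ≡ suc (toℕ i) ⊎ toℕ i ≡ suc (toℕ j)

path : ∀ n → Graph n
path n = record
  { _~_      = Consecutive
  ; _~?_     = λ i j → (toℕ j ℕ.≟ suc (toℕ i)) ⊎-dec (toℕ i ℕ.≟ suc (toℕ j))
  ; ~-sym    = swap
  ; ~-irrefl = λ { refl (inj₁ eq) → ℕ.1+n≢n (sym eq)
                 ; refl (inj₂ eq) → ℕ.1+n≢n (sym eq) }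
  }

IsPath : Graph n → Set
IsPath {n} G = G ≅ path n

IsComponent : Graph n → Subset n → Set
IsComponent G C = ∃[ v ] ∀ u → u ∈ C ⇔ Star (Graph._~_ G) v u

LinearForest : Graph n → Set
LinearForest G = ∀ C → IsComponent G C → IsPath (G [ C ])

------------------------------------------------------------------------
-- Pathwidth

record PathDecomposition (G : Graph n) : Set where
  open Graph G
  field
    bags : List (Subset n)

  bag : Fin (length bags) → Subset n
  bag = List.lookup bags

  field
    coversVertices : ∀ v → ∃[ i ] v ∈ bag i
    coversEdges    : ∀ u v → u ~ v → ∃[ i ] (u ∈ bag i × v ∈ bag i)
    interpolates   : ∀ i l j → i Fin.≤ l → l Fin.≤ j → bag i ∩ bag j ⊆ bag l

  -- An integer: the empty graph has width -1.
  width : ℤ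
  width = max 0 (map ∣_∣ bags) ⊖ 1

record IsPathwidth (G : Graph n) (w : ℤ) : Set where
  open PathDecomposition
  field
    attained : ∃[ D ] width {G = G} D ≡ w
    minimal  : ∀ (D : PathDecomposition G) → w ℤ.≤ width D

PathwidthAtMost : Graph n → ℤ → Set
PathwidthAtMost G b = ∃[ w ] (IsPathwidth G w × w ℤ.≤ b)

------------------------------------------------------------------------
-- Vertex explosion

-- The vertices of the exploded graph are the vertices other than v, followed
-- by one new vertex for each neighbour of v.

module _ (G : Graph n) (v : Fin n) where
  open Graph G

  others : Subset n
  others = ⊤ - v

  explodedOrder : ℕ
  explodedOrder = order others + order (neighbours v)

  ExplodedVertex : Set
  ExplodedVertex = Fin (order others) ⊎ Fin (order (neighbours v))

  ExplodedAdj : Rel ExplodedVertex 0ℓ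
  ExplodedAdj (inj₁ i) (inj₁ j) = nth others i ~ nth others j
  ExplodedAdj (inj₁ i) (inj₂ j) = nth others i ≡ nth (neighbours v) j
  ExplodedAdj (inj₂ i) (inj₁ j) = nth others j ≡ nth (neighbours v) i
  ExplodedAdj (inj₂ i) (inj₂ j) = ⊥

  explodedAdj? : Decidable ExplodedAdj
  explodedAdj? (inj₁ i) (inj₁ j) = nth others i ~? nth others j
  explodedAdj? (inj₁ i) (inj₂ j) = nth others i Fin.≟ nth (neighbours v) j
  explodedAdj? (inj₂ i) (inj₁ j) = nth others j Fin.≟ nth (neighbours v) i
  explodedAdj? (inj₂ i) (inj₂ j) = no λ ()

  explodedAdj-sym : Symmetric ExplodedAdj
  explodedAdj-sym {inj₁ i} {inj₁ j} = ~-sym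
  explodedAdj-sym {inj₁ i} {inj₂ j} eq = eq
  explodedAdj-sym {inj₂ i} {inj₁ j} eq = eq

  explodedAdj-irrefl : Irreflexive _≡_ ExplodedAdj
  explodedAdj-irrefl {inj₁ i} refl = ~-irrefl refl
  explodedAdj-irrefl {inj₂ i} refl ()

  explode : Graph explodedOrder
  explode = record
    { _~_      = λ x y → ExplodedAdj (splitAt _ x) (splitAt _ y)
    ; _~?_     = λ x y → explodedAdj? (splitAt _ x) (splitAt _ y)
    ; ~-sym    = λ {x} {y} → explodedAdj-sym {splitAt _ x} {splitAt _ y}
    ; ~-irrefl = λ { {x} refl → explodedAdj-irrefl {splitAt _ x} refl }
    }

  -- The elements of S other than v, as vertices of the exploded graph.
  survivors : Subset n → Subset explodedOrder
  survivors S = tabulate (λ i → Vec.lookup S (nth others i)) Vec.++ Subset.⊥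

-- ExplodesTo G S H: H arises from G by exploding the vertices of S one after
-- another, in some order.

data ExplodesTo (G : Graph n) (S : Subset n) : ∀ {m} → Graph m → Set₁ where
  done : Empty S → ExplodesTo G S G
  step : ∀ {v m} {H : Graph m} → v ∈ S →
         ExplodesTo (explode G v) (survivors G v S) H → ExplodesTo G S H

------------------------------------------------------------------------
-- Polynomial-time computation

-- The machine model is a multi-stack machine with a structured program: the
-- store consists of a fixed number of stacks over a fixed finite alphabet, and
-- each elementary step pushes, pops or inspects a single top symbol. Since two
-- stacks make up a tape, this agrees with multi-tape Turing machines up to
-- polynomial overhead.

data Symbol : Set where
  𝟎 𝟏 ♯ : Symbol

Store : ℕ → Set
Store r = Vec (List Symbol) r

infixr 5 _⨾_

data Program (r : ℕ) : Set where
  skip          : Program r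
  push          : Fin r → Symbol → Program r
  pop           : Fin r → Program r
  _⨾_           : Program r → Program r → Program r
  ifTop_∈_then_else_ : Fin r → (Maybe Symbol → Bool) → Program r → Program r → Program r
  whileTop_∈_loop_   : Fin r → (Maybe Symbol → Bool) → Program r → Program r

-- The top of a stack, nothing if the stack is empty.
top : Store r → Fin r → Maybe Symbol
top σ x = List.head (Vec.lookup σ x)

infix 4 ⟨_,_⟩⇓[_]_

-- ⟨ c , σ ⟩⇓[ t ] τ: started in store σ, program c halts in store τ after
-- t steps.
data ⟨_,_⟩⇓[_]_ {r} : Program r → Store r → ℕ → Store r → Set where
  skip : ∀ {σ} → ⟨ skip , σ ⟩⇓[ 1 ] σ
  push : ∀ {σ x s} → ⟨ push x s , σ ⟩⇓[ 1 ] σ [ x ]%= (s ∷_)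
  pop  : ∀ {σ x} → ⟨ pop x , σ ⟩⇓[ 1 ] σ [ x ]%= List.drop 1
  _⨾_  : ∀ {c d σ σ′ τ} →
         ⟨ c , σ ⟩⇓[ t₁ ] σ′ → ⟨ d , σ′ ⟩⇓[ t₂ ] τ → ⟨ c ⨾ d , σ ⟩⇓[ t₁ + t₂ ] τ
  if-true : ∀ {x p c d σ τ} → p (top σ x) ≡ true →
            ⟨ c , σ ⟩⇓[ t ] τ → ⟨ ifTop x ∈ p then c else d , σ ⟩⇓[ suc t ] τ
  if-false : ∀ {x p c d σ τ} → p (top σ x) ≡ false →
             ⟨ d , σ ⟩⇓[ t ] τ → ⟨ ifTop x ∈ p then c else d , σ ⟩⇓[ suc t ] τ
  while-true : ∀ {x p c σ σ′ τ} → p (top σ x) ≡ true →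
               ⟨ c , σ ⟩⇓[ t₁ ] σ′ → ⟨ whileTop x ∈ p loop c , σ′ ⟩⇓[ t₂ ] τ →
               ⟨ whileTop x ∈ p loop c , σ ⟩⇓[ suc (t₁ + t₂) ] τ
  while-false : ∀ {x p c σ} → p (top σ x) ≡ false →
                ⟨ whileTop x ∈ p loop c , σ ⟩⇓[ 1 ] σ

-- The input is on stack zero, first symbol on top, with all other stacks
-- empty; the output is left on stack zero.
initial : List Symbol → Store (suc r)
initial w = w Vec.∷ replicate _ []

output : Store (suc r) → List Symbol
output = Vec.head

-- Every polynomial over ℕ is bounded by one of the form a * n ^ d + a.
PolyTime : {A B : Set₁} → (A → List Symbol) → (B → List Symbol) → (A → B) → Set₁
PolyTime {A} encA encB f =
  ∃[ r ] Σ[ c ∈ Program (suc r) ] ∃[ a ] ∃[ d ] ∀ (x : A) →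
    ∃[ t ] ∃[ τ ] ( ⟨ c , initial (encA x) ⟩⇓[ t ] τ
                  × output τ ≡ encB (f x)
                  × t ≤ a * length (encA x) ^ d + a )

------------------------------------------------------------------------
-- Parameterized problems

record ParameterizedProblem (ℓ : Level) : Set (Level.suc (Level.suc 0ℓ) ⊔ Level.suc ℓ) where
  field
    Instance  : Set₁
    encode    : Instance → List Symbol
    parameter : Instance → ℕ
    Yes       : Instance → Set ℓ

ParameterPreservingReduction : ∀ {p q} → ParameterizedProblem p → ParameterizedProblem q →
                               Set (Level.suc 0ℓ ⊔ p ⊔ q)
ParameterPreservingReduction P Q =
  Σ[ f ∈ (P.Instance → Q.Instance) ]
    PolyTime P.encode Q.encode f ×
    (∀ I → Q.parameter (f I) ≤ P.parameter I × (P.Yes I ⇔ Q.Yes (f I)))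
  where
  module P = ParameterizedProblem P
  module Q = ParameterizedProblem Q

-- Graphs are encoded by the rows of the adjacency matrix, each ended by ♯,
-- vertex sets by their characteristic vectors, and numbers in binary, least
-- significant digit first.

bit : Bool → Symbol
bit b = if b then 𝟏 else 𝟎

encodeSubset : Subset n → List Symbol
encodeSubset p = map bit (Vec.toList p)

encodeGraph : Graph n → List Symbol
encodeGraph G = concatMap (λ v → encodeSubset (neighbours v) ++ ♯ ∷ []) (allFin _)
  where open Graph G

encodeℕ : ℕ → List Symbol
encodeℕ k = map digit (proj₁ (toDigits 2 k))
  where
  digit : Fin 2 → Symbol
  digit zero       = 𝟎
  digit (suc zero) = 𝟏

record GraphInstance : Set₁ where
  constructor mkInstance
  field
    {size} : ℕ
    graph  : Graph size
    k      : ℕ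

record RestrictedGraphInstance : Set₁ where
  constructor mkRestricted
  field
    {size} : ℕ
    graph  : Graph size
    X      : Subset size
    k      : ℕ

encodeInstance : GraphInstance → List Symbol
encodeInstance (mkInstance G k) = encodeGraph G ++ ♯ ∷ encodeℕ k

encodeRestricted : RestrictedGraphInstance → List Symbol
encodeRestricted (mkRestricted G X k) =
  encodeGraph G ++ ♯ ∷ encodeSubset X ++ ♯ ∷ encodeℕ k

ExplosionSet : Graph n → Subset n → Set₁
ExplosionSet G S = ∃[ m ] Σ[ H ∈ Graph m ] ExplodesTo G S H × PathwidthAtMost H (+ 1)

CoPathSet : Graph n → Subset n → Set
CoPathSet G S = LinearForest (delete G S)

POVE : ParameterizedProblem (Level.suc 0ℓ)
POVE = record
  { Instance  = GraphInstance
  ; encode    = encodeInstance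
  ; parameter = GraphInstance.k
  ; Yes       = λ (mkInstance {n} G k) →
      Σ[ S ∈ Subset n ] ∣ S ∣ ≤ k × ExplosionSet G S
  }

RestrictedPOVE : ParameterizedProblem (Level.suc 0ℓ)
RestrictedPOVE = record
  { Instance  = RestrictedGraphInstance
  ; encode    = encodeRestricted
  ; parameter = RestrictedGraphInstance.k
  ; Yes       = λ (mkRestricted {n} G X k) →
      Σ[ S ∈ Subset n ] S ⊆ X × ∣ S ∣ ≤ k × ExplosionSet G S
  }

CPP : ParameterizedProblem 0ℓ
CPP = record
  { Instance  = GraphInstance
  ; encode    = encodeInstance
  ; parameter = GraphInstance.k
  ; Yes       = λ (mkInstance {n} G k) →
      Σ[ S ∈ Subset n ] ∣ S ∣ ≤ k × CoPathSet G S
  }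

RestrictedCPP : ParameterizedProblem 0ℓ
RestrictedCPP = record
  { Instance  = RestrictedGraphInstance
  ; encode    = encodeRestricted
  ; parameter = RestrictedGraphInstance.k
  ; Yes       = λ (mkRestricted {n} G X k) →
      Σ[ S ∈ Subset n ] S ⊆ X × ∣ S ∣ ≤ k × CoPathSet G S
  }

{-# OPTIONS --safe #-}

-- A graph has pathwidth at most one iff its vertices of degree at least two
-- induce a linear forest. Exploding S preserves the degrees of the vertices
-- outside S and creates vertices of degree one only, so the vertices of degree
-- at least two of the exploded graph are those of G outside S. The reduction
-- therefore removes from G all edges at vertices of degree at most one; the
-- vertex set, X, k and the solutions stay the same.

module Submission where

open import Defs
open import Data.Bool.Base using (Bool; true; false; _∧_; not; if_then_else_)
open import Data.Fin.Base as Fin using (Fin; zero; suc; toℕ; splitAt; join; _↑ˡ_; combine; inject≤)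
open import Data.Fin.Patterns using (0F; 1F; 2F; 3F; 4F)
import Data.Fin.Properties as Fin
open import Data.Fin.Subset as Subset using (Subset; inside; outside; _∈_; _∉_; _-_; ∣_∣; ∁; ⊤; Empty)
open import Data.Fin.Subset.Properties
  using ( _∈?_; p⊂q⇒∣p∣<∣q∣; x∈p∧x≢y⇒x∈p-y; x∈p⇒∣p-x∣<∣p∣; ∈⊤; ∣⊤∣≡n; x∈∁p⇒x∉p; x∉p⇒x∈∁p
        ; x∈p∩q⁺; x∈p∩q⁻)
import Data.Integer.Base as ℤ
open ℤ using (_⊖_)
import Data.Integer.Properties as ℤ
open import Data.List.Base as List
  using (List; []; _∷_; _++_; allFin; applyUpTo; concatMap; foldr; length; map; _ʳ++_)
open import Data.List.Extrema.Nat using (max; max≤v⁺; xs≤max)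
open import Data.List.Membership.Propositional.Properties using (∈-filter⁺; ∈-filter⁻; ∈-lookup; ∈-allFin; ∈-map⁺)
import Data.List.Properties as List
import Data.List.Relation.Unary.All as All
import Data.List.Relation.Unary.All.Properties as All
open import Data.List.Relation.Unary.AllPairs using (_∷_)
import Data.List.Relation.Unary.Any as Any
open import Data.List.Relation.Unary.Any.Properties using (lookup-index)
open import Data.List.Relation.Unary.Unique.Propositional using (Unique)
import Data.List.Relation.Unary.Unique.Propositional.Properties as Unique
open import Data.Maybe.Base using (Maybe; just; nothing; is-just)
open import Data.Nat.Base using (ℕ; zero; suc; _+_; _*_; _^_; _≤_; _<_; z≤n; s≤s)
import Data.Nat.Properties as ℕ
open import Data.Nat.Solver using (module +-*-Solver)
open import Data.Product.Base using (∃-syntax; Σ-syntax; _×_; _,_; proj₁; proj₂)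
open import Data.Sum.Base using (_⊎_; inj₁; inj₂; [_,_]′)
open import Data.Sum.Properties using (inj₁-injective)
open import Data.Unit.Base using (tt)
open import Data.Vec.Base as Vec using (_∷_; []; here; there; tabulate; toList)
open import Data.Vec.Properties
  using (lookup⇒[]=; []=⇒lookup; lookup∘tabulate; lookup-replicate; lookup-splitAt)
open import Function.Base using (_∘_; const; id)
open import Function.Bundles using (_⇔_; _↔_; mk⇔; mk↔ₛ′; Equivalence; Injection; Inverse)
open import Function.Properties.Inverse using (↔⇒↣)
open import Level using (Level; 0ℓ)
open import Relation.Binary.Construct.Closure.ReflexiveTransitive using (Star; ε; _◅_; _◅◅_; reverse)
open import Relation.Binary.Core using (Rel)
import Relation.Binary.Definitions as Binary
open Binary using (Tri; tri<; tri≈; tri>)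
open import Relation.Binary.PropositionalEquality hiding ([_])
open import Relation.Nullary using (¬_; Dec; yes; no; contradiction)
open import Relation.Nullary.Decidable using (does; dec-true; map′; ¬?; _×-dec_; _⊎-dec_; decidable-stable)
open import Relation.Unary using (Pred; Decidable)

open Equivalence using (to; from)

-- The low-degree test is made once, in `G`: a vertex may have degree one in `core G` and still keep
-- its edge there. Edges are removed rather than vertices because isolated vertices do no harm in a
-- linear forest, and because the vertex numbering, and with it `S` and `X`, then carries over
-- literally. The two directions of the pathwidth criterion pass through different notions. A
-- decomposition only orders vertices; the resulting `Layout` of the core of the exploded graph is
-- pulled back along an injection of the vertices outside `S`. Building a decomposition needs an
-- `Arrangement`, where adjacent vertices are consecutive; it is pushed forward along the same
-- injection, as the vertices outside its image are isolated in the core of the exploded graph.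

private
  variable
    ℓ : Level
    m n r β β₁ β₂ : ℕ
    σ σ′ τ : Store r
    c d : Program r

-- Finite subsets

module _ {P : Pred (Fin n) ℓ} (P? : Decidable P) where

  ∈-tabulate⁺ : ∀ {i} → P i → i ∈ tabulate (λ j → does (P? j))
  ∈-tabulate⁺ {i} p = lookup⇒[]= i _ (trans (lookup∘tabulate _ i) (dec-true (P? i) p))

  ∈-tabulate⁻ : ∀ {i} → i ∈ tabulate (λ j → does (P? j)) → P i
  ∈-tabulate⁻ {i} i∈ with P? i | trans (sym (lookup∘tabulate (does ∘ P?) i)) ([]=⇒lookup i∈)
  ... | yes p | _ = p

least : {P : Pred (Fin n) ℓ} → Decidable P → ∃[ i ] P i → ∃[ i ] (P i × ∀ j → P j → i Fin.≤ j)
least {n = suc n} P? (i , pi) with P? zero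
... | yes p0 = zero , p0 , λ _ _ → z≤n
... | no ¬p0 with i
...   | zero   = contradiction pi ¬p0
...   | suc i′ with least (P? ∘ suc) (i′ , pi)
...     | l , pl , l≤ = suc l , pl , λ { zero p0 → contradiction p0 ¬p0 ; (suc j) pj → s≤s (l≤ j pj) }

-- Pigeonhole: a value missed by `f` can be punched out, which leaves an injection from
-- `Fin (suc n)` into `Fin n`.
injective⇒surjective : {f : Fin n → Fin n} → (∀ {i j} → f i ≡ f j → i ≡ j) → ∀ y → ∃[ i ] f i ≡ y
injective⇒surjective {n = suc n} {f} inj y with Fin.any? (λ i → f i Fin.≟ y)
... | yes hit = hit
... | no miss = contradiction
  (Fin.injective⇒≤ {f = λ i → Fin.punchOut (λ eq → miss (i , sym eq))}
    (λ {i} {j} eq → inj (Fin.punchOut-injective (λ eq′ → miss (i , sym eq′)) (λ eq′ → miss (j , sym eq′)) eq)))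
  (ℕ.<-irrefl refl)

-- Upper bounds on bags and degrees come from here: with `⊤ {w}` for `q`, `f` is a colouring of `p`
-- with `w` colours.
∣∣-injection : (p : Subset m) (q : Subset n) (f : Fin m → Fin n) →
  (∀ {i} → i ∈ p → f i ∈ q) → (∀ {i j} → i ∈ p → j ∈ p → f i ≡ f j → i ≡ j) → ∣ p ∣ ≤ ∣ q ∣
∣∣-injection []            q f _   _   = z≤n
∣∣-injection (outside ∷ p) q f f∈q inj =
  ∣∣-injection p q (f ∘ suc) (f∈q ∘ there) (λ i∈ j∈ eq → Fin.suc-injective (inj (there i∈) (there j∈) eq))
∣∣-injection (inside ∷ p)  q f f∈q inj = ℕ.≤-<-trans
  (∣∣-injection p (q - f zero) (f ∘ suc)
    (λ i∈ → x∈p∧x≢y⇒x∈p-y (f∈q (there i∈)) (λ eq → Fin.0≢1+n (sym (inj (there i∈) here eq))))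
    (λ i∈ j∈ eq → Fin.suc-injective (inj (there i∈) (there j∈) eq)))
  (x∈p⇒∣p-x∣<∣p∣ (f∈q here))

distinct₂⇒2≤∣p∣ : {p : Subset n} {x y : Fin n} → x ∈ p → y ∈ p → x ≢ y → 2 ≤ ∣ p ∣
distinct₂⇒2≤∣p∣ x∈p y∈p x≢y = ℕ.≤-trans
  (s≤s (ℕ.≤-trans (s≤s z≤n) (x∈p⇒∣p-x∣<∣p∣ (x∈p∧x≢y⇒x∈p-y x∈p x≢y))))
  (x∈p⇒∣p-x∣<∣p∣ y∈p)

distinct₃⇒3≤∣p∣ : {p : Subset n} {x y z : Fin n} → x ∈ p → y ∈ p → z ∈ p →
  x ≢ y → x ≢ z → y ≢ z → 3 ≤ ∣ p ∣
distinct₃⇒3≤∣p∣ x∈p y∈p z∈p x≢y x≢z y≢z = ℕ.≤-trans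
  (s≤s (distinct₂⇒2≤∣p∣ (x∈p∧x≢y⇒x∈p-y x∈p x≢z) (x∈p∧x≢y⇒x∈p-y y∈p y≢z) x≢y))
  (x∈p⇒∣p-x∣<∣p∣ z∈p)

lookup-injective : {A : Set} {xs : List A} → Unique xs →
  ∀ i j → List.lookup xs i ≡ List.lookup xs j → i ≡ j
lookup-injective (x∉ ∷ _)  zero    zero    _  = refl
lookup-injective (x∉ ∷ _)  zero    (suc j) eq = contradiction eq (All.lookup x∉ (∈-lookup j))
lookup-injective (x∉ ∷ _)  (suc i) zero    eq = contradiction (sym eq) (All.lookup x∉ (∈-lookup i))
lookup-injective (_ ∷ xs!) (suc i) (suc j) eq = cong suc (lookup-injective xs! i j eq)

module _ (p : Subset n) where

  nth-∈ : ∀ i → nth p i ∈ p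
  nth-∈ i = proj₂ (∈-filter⁻ (_∈? p) {xs = allFin n} (∈-lookup i))

  nth-injective : ∀ {i j} → nth p i ≡ nth p j → i ≡ j
  nth-injective = lookup-injective (Unique.filter⁺ (_∈? p) (Unique.allFin⁺ n)) _ _

  index : ∀ {v} → v ∈ p → Fin (order p)
  index {v} v∈p = Any.index (∈-filter⁺ (_∈? p) (∈-allFin v) v∈p)

  nth-index : ∀ {v} (v∈p : v ∈ p) → nth p (index v∈p) ≡ v
  nth-index {v} v∈p = sym (lookup-index (∈-filter⁺ (_∈? p) (∈-allFin v) v∈p))

  order≤n : order p ≤ n
  order≤n = Fin.injective⇒≤ nth-injective

-- Turns arbitrary distinct keys into positions without gaps: the rank is the number of smaller
-- keys.
module Sorting {c : ℕ} (key : Fin c → ℕ) (key-injective : ∀ {i j} → key i ≡ key j → i ≡ j) where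

  below : Fin c → Subset c
  below i = tabulate (λ j → does (key j ℕ.<? key i))

  i∉below : ∀ i → i ∉ below i
  i∉below i i∈ = ℕ.<-irrefl refl (∈-tabulate⁻ (λ j → key j ℕ.<? key i) i∈)

  ∣below∣< : ∀ i → ∣ below i ∣ < c
  ∣below∣< i = ℕ.<-≤-trans (p⊂q⇒∣p∣<∣q∣ ((λ _ → ∈⊤) , i , ∈⊤ , i∉below i)) (ℕ.≤-reflexive (∣⊤∣≡n c))

  ∣below∣-mono : ∀ {i j} → key i < key j → ∣ below i ∣ < ∣ below j ∣
  ∣below∣-mono {i} {j} i<j = p⊂q⇒∣p∣<∣q∣
    ( (λ k∈ → ∈-tabulate⁺ (λ k → key k ℕ.<? key j) (ℕ.<-trans (∈-tabulate⁻ (λ k → key k ℕ.<? key i) k∈) i<j))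
    , i , ∈-tabulate⁺ (λ k → key k ℕ.<? key j) i<j , i∉below i)

  rank : Fin c → Fin c
  rank i = Fin.fromℕ< (∣below∣< i)

  rank-mono : ∀ {i j} → key i < key j → rank i Fin.< rank j
  rank-mono {i} {j} i<j = subst₂ _<_ (sym (Fin.toℕ-fromℕ< (∣below∣< i))) (sym (Fin.toℕ-fromℕ< (∣below∣< j))) (∣below∣-mono i<j)

  rank-cancel : ∀ {i j} → rank i Fin.< rank j → key i < key j
  rank-cancel {i} {j} i<j with ℕ.<-cmp (key i) (key j)
  ... | tri< lt _ _ = lt
  ... | tri≈ _ eq _ = contradiction (cong (toℕ ∘ rank) (key-injective eq)) (ℕ.<⇒≢ i<j)
  ... | tri> _ _ gt = contradiction (rank-mono gt) (ℕ.<-asym i<j)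

  rank-injective : ∀ {i j} → rank i ≡ rank j → i ≡ j
  rank-injective {i} {j} eq with ℕ.<-cmp (key i) (key j)
  ... | tri< lt _ _ = contradiction (cong toℕ eq) (ℕ.<⇒≢ (rank-mono lt))
  ... | tri≈ _ eq′ _ = key-injective eq′
  ... | tri> _ _ gt = contradiction (cong toℕ (sym eq)) (ℕ.<⇒≢ (rank-mono gt))

  unrank : Fin c → Fin c
  unrank y = proj₁ (injective⇒surjective rank-injective y)

  rank-unrank : ∀ y → rank (unrank y) ≡ y
  rank-unrank y = proj₂ (injective⇒surjective rank-injective y)

  rank-↔ : Fin c ↔ Fin c
  rank-↔ = mk↔ₛ′ rank unrank rank-unrank (λ i → rank-injective (rank-unrank (rank i)))

-- Vertex explosion

∉- : (p : Subset n) (v : Fin n) → v ∉ p - v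
∉- (_ ∷ p) (suc v) (there v∈) = ∉- p v v∈
∉- (Subset.inside ∷ p) zero ()
∉- (Subset.outside ∷ p) zero ()

AtMostOne : {A B : Set} → (A → B → Set) → A → Set
AtMostOne R a = ∀ b c → R a b → R a c → b ≡ c

module _ (G : Graph n) where
  open Graph G

  -- Degree at most one without counting, in a form that also applies to the sum type
  -- `ExplodedVertex`.
  Thin : Fin n → Set
  Thin = AtMostOne _~_

  ∈-neighbours⁺ : ∀ {u v} → v ~ u → u ∈ neighbours v
  ∈-neighbours⁺ {v = v} = ∈-tabulate⁺ (v ~?_)

  ∈-neighbours⁻ : ∀ {u v} → u ∈ neighbours v → v ~ u
  ∈-neighbours⁻ {v = v} = ∈-tabulate⁻ (v ~?_)

  -- Decided by counting, so that its Boolean unfolds to the comparison of `∣ neighbours v ∣` with 1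
  -- that the program is shown to compute.
  thin? : ∀ v → Dec (Thin v)
  thin? v = map′ few⇒thin thin⇒few (∣ neighbours v ∣ ℕ.≤? 1)
    where
    few⇒thin : ∣ neighbours v ∣ ≤ 1 → Thin v
    few⇒thin few u w v~u v~w = decidable-stable (u Fin.≟ w) λ u≢w →
      ℕ.<⇒≱ (distinct₂⇒2≤∣p∣ (∈-neighbours⁺ v~u) (∈-neighbours⁺ v~w) u≢w) few
    thin⇒few : Thin v → ∣ neighbours v ∣ ≤ 1
    thin⇒few thin = ∣∣-injection (neighbours v) (⊤ {1}) (const zero) (const ∈⊤)
      (λ u∈ w∈ _ → thin _ _ (∈-neighbours⁻ u∈) (∈-neighbours⁻ w∈))

  core : Graph n
  core = record
    { _~_      = λ u v → u ~ v × ¬ Thin u × ¬ Thin v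
    ; _~?_     = λ u v → (u ~? v) ×-dec ¬? (thin? u) ×-dec ¬? (thin? v)
    ; ~-sym    = λ (u~v , u , v) → ~-sym u~v , v , u
    ; ~-irrefl = λ u≡v (u~v , _) → ~-irrefl u≡v u~v
    }

module _ (G : Graph n) (v : Fin n) where
  open Graph G
  private
    E = explode G v
    module E = Graph E

  ∈-others : ∀ {u} → u ≢ v → u ∈ others G v
  ∈-others = x∈p∧x≢y⇒x∈p-y ∈⊤

  nth-others≢ : ∀ o → nth (others G v) o ≢ v
  nth-others≢ o eq = ∉- _ v (subst (_∈ others G v) eq (nth-∈ (others G v) o))

  old : ∀ {u} → u ≢ v → Fin (order (others G v))
  old u≢v = index (others G v) (∈-others u≢v)

  nth-old : ∀ {u} (u≢v : u ≢ v) → nth (others G v) (old u≢v) ≡ u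
  nth-old u≢v = nth-index (others G v) (∈-others u≢v)

  new : ∀ {u} → v ~ u → Fin (order (neighbours v))
  new v~u = index (neighbours v) (∈-neighbours⁺ G v~u)

  nth-new : ∀ {u} (v~u : v ~ u) → nth (neighbours v) (new v~u) ≡ u
  nth-new v~u = nth-index (neighbours v) (∈-neighbours⁺ G v~u)

  v~nth : ∀ j → v ~ nth (neighbours v) j
  v~nth j = ∈-neighbours⁻ G (nth-∈ (neighbours v) j)

  split : Fin (explodedOrder G v) → ExplodedVertex G v
  split = splitAt (order (others G v))

  split-injective : ∀ {x y} → split x ≡ split y → x ≡ y
  split-injective {x} {y} eq = begin
    x                 ≡⟨ Fin.join-splitAt a b x ⟨
    join a b (split x) ≡⟨ cong (join a b) eq ⟩
    join a b (split y) ≡⟨ Fin.join-splitAt a b y ⟩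
    y                 ∎
    where
    open ≡-Reasoning
    a = order (others G v)
    b = order (neighbours v)

  private
    _≈_ : Rel (ExplodedVertex G v) 0ℓ
    _≈_ = ExplodedAdj G v

  -- A new vertex attached to `o` stands for its neighbour `v`. Hence it cannot occur together with
  -- an old neighbour, which differs from `v`.
  thin-old⁺ : ∀ o → Thin G (nth (others G v) o) → AtMostOne _≈_ (inj₁ o)
  thin-old⁺ o thin (inj₁ a) (inj₁ b) p q = cong inj₁ (nth-injective (others G v) (thin _ _ p q))
  thin-old⁺ o thin (inj₁ a) (inj₂ b) p q =
    contradiction (thin _ _ p (subst (_~ v) (sym q) (~-sym (v~nth b)))) (nth-others≢ a)
  thin-old⁺ o thin (inj₂ a) (inj₁ b) p q =
    contradiction (thin _ _ q (subst (_~ v) (sym p) (~-sym (v~nth a)))) (nth-others≢ b)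
  thin-old⁺ o thin (inj₂ a) (inj₂ b) p q = cong inj₂ (nth-injective (neighbours v) (trans (sym p) q))

  thin-old⁻ : ∀ o → AtMostOne _≈_ (inj₁ o) → Thin G (nth (others G v) o)
  thin-old⁻ o thin a b p q with a Fin.≟ v | b Fin.≟ v
  ... | yes refl | yes refl = refl
  ... | no a≢v   | no b≢v   = trans (sym (nth-old a≢v))
    (trans (cong (nth (others G v)) (inj₁-injective (thin (inj₁ (old a≢v)) (inj₁ (old b≢v)) (subst (_ ~_) (sym (nth-old a≢v)) p)
                                                         (subst (_ ~_) (sym (nth-old b≢v)) q))))
           (nth-old b≢v))
  ... | yes refl | no b≢v   = contradiction
    (thin (inj₂ (new (~-sym p))) (inj₁ (old b≢v)) (sym (nth-new (~-sym p))) (subst (_ ~_) (sym (nth-old b≢v)) q)) λ ()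
  ... | no a≢v   | yes refl = contradiction
    (thin (inj₂ (new (~-sym q))) (inj₁ (old a≢v)) (sym (nth-new (~-sym q))) (subst (_ ~_) (sym (nth-old a≢v)) p)) λ ()

  thin-new : ∀ j → AtMostOne _≈_ (inj₂ j)
  thin-new j (inj₁ a) (inj₁ b) p q = cong inj₁ (nth-injective (others G v) (trans p (sym q)))

  module _ {x : Fin (explodedOrder G v)} {s : ExplodedVertex G v} (eq : split x ≡ s) where

    thin-explode⁺ : AtMostOne _≈_ s → Thin E x
    thin-explode⁺ thin y z x~y x~z = split-injective
      (thin (split y) (split z) (subst (_≈ split y) eq x~y) (subst (_≈ split z) eq x~z))

    thin-explode⁻ : Thin E x → AtMostOne _≈_ s
    thin-explode⁻ thin y z s≈y s≈z = begin
      y                        ≡⟨ Fin.splitAt-join _ _ y ⟨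
      split (join _ _ y)   ≡⟨ cong split (thin _ _ (adj s≈y) (adj s≈z)) ⟩
      split (join _ _ z)   ≡⟨ Fin.splitAt-join _ _ z ⟩
      z                        ∎
      where
      open ≡-Reasoning
      adj : ∀ {t} → s ≈ t → x E.~ join _ _ t
      adj {t} = subst₂ _≈_ (sym eq) (sym (Fin.splitAt-join _ _ t))

  split-old : ∀ o → split (o ↑ˡ order (neighbours v)) ≡ inj₁ o
  split-old o = Fin.splitAt-↑ˡ _ o _

  adj-old : ∀ a b → nth (others G v) a ~ nth (others G v) b ⇔ (a ↑ˡ order (neighbours v)) E.~ (b ↑ˡ order (neighbours v))
  adj-old a b = mk⇔ (subst₂ _≈_ (sym (split-old a)) (sym (split-old b)))
                    (subst₂ _≈_ (split-old a) (split-old b))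

  lookup-survivors : ∀ S x → Vec.lookup (survivors G v S) x ≡
                     [ Vec.lookup S ∘ nth (others G v) , const Subset.outside ]′ (split x)
  lookup-survivors S x = trans (lookup-splitAt _ (tabulate (λ i → Vec.lookup S (nth (others G v) i))) Subset.⊥ x) (lem (split x))
    where
    lem : ∀ s → [ Vec.lookup (tabulate (λ i → Vec.lookup S (nth (others G v) i))) , Vec.lookup Subset.⊥ ]′ s ≡
          [ Vec.lookup S ∘ nth (others G v) , const Subset.outside ]′ s
    lem (inj₁ o) = lookup∘tabulate _ o
    lem (inj₂ j) = lookup-replicate j Subset.outside

  ∈-survivors⁺ : ∀ {S x o} → split x ≡ inj₁ o → nth (others G v) o ∈ S → x ∈ survivors G v S
  ∈-survivors⁺ {S} {x} eq o∈ = lookup⇒[]= x _ (trans (lookup-survivors S x)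
    (trans (cong [ _ , _ ]′ eq) ([]=⇒lookup o∈)))

  ∈-survivors⁻ : ∀ {S x} → x ∈ survivors G v S → ∃[ o ] (split x ≡ inj₁ o × nth (others G v) o ∈ S)
  ∈-survivors⁻ {S} {x} x∈ with split x | trans (sym (lookup-survivors S x)) ([]=⇒lookup x∈)
  ... | inj₁ o | eq = o , refl , lookup⇒[]= _ S eq
  ... | inj₂ _ | ()

  ∣survivors∣< : ∀ {S} → v ∈ S → ∣ survivors G v S ∣ < ∣ S ∣
  ∣survivors∣< {S} v∈S = ℕ.≤-<-trans (∣∣-injection (survivors G v S) (S - v) f f∈ f-inj) (x∈p⇒∣p-x∣<∣p∣ v∈S)
    where
    f : Fin (explodedOrder G v) → Fin n
    -- The value `v` on new vertices is a mere default: `survivors` contains old vertices only.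
    f x = [ nth (others G v) , const v ]′ (split x)
    f∈ : ∀ {x} → x ∈ survivors G v S → f x ∈ S - v
    f∈ {x} x∈ with ∈-survivors⁻ {S} x∈
    ... | o , eq , o∈ rewrite eq = x∈p∧x≢y⇒x∈p-y o∈ (nth-others≢ o)
    f-inj : ∀ {x y} → x ∈ survivors G v S → y ∈ survivors G v S → f x ≡ f y → x ≡ y
    f-inj {x} {y} x∈ y∈ fx≡fy with ∈-survivors⁻ {S} x∈ | ∈-survivors⁻ {S} y∈
    ... | a , eqa , _ | b , eqb , _ rewrite eqa | eqb =
      split-injective (trans eqa (trans (cong inj₁ (nth-injective (others G v) fx≡fy)) (sym eqb)))

-- The direction that starts from a linear forest has to produce an exploded graph. The recursion is
-- on a bound for `∣ S ∣`, since the graph itself grows.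
explosion : (G : Graph n) (S : Subset n) → ∃[ m ] Σ[ H ∈ Graph m ] ExplodesTo G S H
explosion {n} G S = go G S ℕ.≤-refl
  where
  go : ∀ {n c} (G : Graph n) (S : Subset n) → ∣ S ∣ ≤ c → ∃[ m ] Σ[ H ∈ Graph m ] ExplodesTo G S H
  go {n} {c} G S bound with Fin.any? (_∈? S)
  ... | no empty = n , G , done empty
  go {n} {zero} G S bound | yes (v , v∈S) = contradiction (ℕ.≤-trans (∣survivors∣< G v v∈S) bound) λ ()
  go {n} {suc c} G S bound | yes (v , v∈S)
    with m , H , e ← go {c = c} (explode G v) (survivors G v S) (ℕ.≤-pred (ℕ.≤-trans (∣survivors∣< G v v∈S) bound))
    = m , H , step v∈S e

-- What a sequence of explosions leaves of a graph

record Remnant (G : Graph n) (S : Subset n) (H : Graph m) : Set where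
  private
    module G = Graph G
    module H = Graph H
  field
    ι           : Fin (order (∁ S)) → Fin m
    ι-injective : ∀ {i j} → ι i ≡ ι j → i ≡ j
    ι-adj       : ∀ i j → nth (∁ S) i G.~ nth (∁ S) j ⇔ ι i H.~ ι j
    ι-thin      : ∀ i → Thin G (nth (∁ S) i) ⇔ Thin H (ι i)
    ι-cover     : ∀ x → ∃[ i ] ι i ≡ x ⊎ Thin H x

module _ (G : Graph n) {S : Subset n} where
  open Graph G

  remnant-done : Empty S → Remnant G S G
  remnant-done empty = record
    { ι           = nth (∁ S)
    ; ι-injective = nth-injective (∁ S)
    ; ι-adj       = λ i j → mk⇔ (λ p → p) (λ p → p)
    ; ι-thin      = λ i → mk⇔ (λ t → t) (λ t → t)
    ; ι-cover     = λ x → let x∈ = x∉p⇒x∈∁p (λ x∈S → empty (x , x∈S)) in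
                          inj₁ (index (∁ S) x∈ , nth-index (∁ S) x∈)
    }

  -- A vertex outside `S` is not `v`, so it becomes an old vertex outside `survivors`; the map of
  -- the remaining explosions is applied to its number `i′ i` there.
  remnant-step : ∀ {v} {H : Graph m} → v ∈ S → Remnant (explode G v) (survivors G v S) H → Remnant G S H
  remnant-step {v = v} {H} v∈S R = record
    { ι           = λ i → R.ι (i′ i)
    ; ι-injective = λ {i} {j} eq → nth-injective (∁ S) (begin
        nth (∁ S) i              ≡⟨ nth-o i ⟨
        nth (others G v) (o i)   ≡⟨ cong (nth (others G v)) (Fin.↑ˡ-injective _ _ _ (trans (sym (nth-i′ i)) (trans (cong (nth Q) (R.ι-injective eq)) (nth-i′ j)))) ⟩
        nth (others G v) (o j)   ≡⟨ nth-o j ⟩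
        nth (∁ S) j              ∎)
    ; ι-adj       = λ i j → mk⇔
        (λ p → to (R.ι-adj (i′ i) (i′ j)) (subst₂ E._~_ (sym (nth-i′ i)) (sym (nth-i′ j))
          (to (adj-old G v (o i) (o j)) (subst₂ _~_ (sym (nth-o i)) (sym (nth-o j)) p))))
        (λ p → subst₂ _~_ (nth-o i) (nth-o j) (from (adj-old G v (o i) (o j))
          (subst₂ E._~_ (nth-i′ i) (nth-i′ j) (from (R.ι-adj (i′ i) (i′ j)) p))))
    ; ι-thin      = λ i → mk⇔
        (λ t → to (R.ι-thin (i′ i)) (thin-explode⁺ G v (split-i′ i)
          (thin-old⁺ G v (o i) (subst (Thin G) (sym (nth-o i)) t))))
        (λ t → subst (Thin G) (nth-o i) (thin-old⁻ G v (o i)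
          (thin-explode⁻ G v (split-i′ i) (from (R.ι-thin (i′ i)) t))))
    ; ι-cover     = cover
    }
    where
    open ≡-Reasoning
    module R = Remnant R
    module E = Graph (explode G v)
    Q = ∁ (survivors G v S)

    nth∉S : ∀ i → nth (∁ S) i ∉ S
    nth∉S i = x∈∁p⇒x∉p (nth-∈ (∁ S) i)

    nth≢v : ∀ i → nth (∁ S) i ≢ v
    nth≢v i eq = nth∉S i (subst (_∈ S) (sym eq) v∈S)

    o : ∀ i → Fin (order (others G v))
    o i = old G v (nth≢v i)

    nth-o : ∀ i → nth (others G v) (o i) ≡ nth (∁ S) i
    nth-o i = nth-old G v (nth≢v i)

    o∈Q : ∀ i → o i ↑ˡ _ ∈ Q
    o∈Q i = x∉p⇒x∈∁p λ o∈ → let b , eq , b∈ = ∈-survivors⁻ G v {S} o∈ in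
      nth∉S i (subst (_∈ S) (trans (cong (nth (others G v)) (inj₁-injective (trans (sym eq) (split-old G v (o i))))) (nth-o i)) b∈)

    i′ : ∀ i → Fin (order Q)
    i′ i = index Q (o∈Q i)

    nth-i′ : ∀ i → nth Q (i′ i) ≡ o i ↑ˡ _
    nth-i′ i = nth-index Q (o∈Q i)

    split-i′ : ∀ i → split G v (nth Q (i′ i)) ≡ inj₁ (o i)
    split-i′ i = trans (cong (split G v) (nth-i′ i)) (split-old G v (o i))

    covered : ∀ j s → split G v (nth Q j) ≡ s → ∃[ i ] R.ι (i′ i) ≡ R.ι j ⊎ Thin H (R.ι j)
    covered j (inj₂ b) eq = inj₂ (to (R.ι-thin j) (thin-explode⁺ G v eq (thin-new G v b)))
    covered j (inj₁ a) eq = inj₁ (i , cong R.ι (nth-injective Q (trans (nth-i′ i)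
        (split-injective G v (trans (split-old G v (o i)) (trans (cong inj₁ o≡a) (sym eq)))))))
      where
      a∈ : nth (others G v) a ∈ ∁ S
      a∈ = x∉p⇒x∈∁p (λ a∈S → x∈∁p⇒x∉p (nth-∈ Q j) (∈-survivors⁺ G v eq a∈S))
      i = index (∁ S) a∈
      o≡a : o i ≡ a
      o≡a = nth-injective (others G v) (trans (nth-o i) (nth-index (∁ S) a∈))

    cover : ∀ x → ∃[ i ] R.ι (i′ i) ≡ x ⊎ Thin H x
    cover x = [ (λ (j , eq) → subst (λ y → ∃[ i ] R.ι (i′ i) ≡ y ⊎ Thin H y) eq (covered j _ refl)) , inj₂ ]′ (R.ι-cover x)

remnant : {G : Graph n} {S : Subset n} {H : Graph m} → ExplodesTo G S H → Remnant G S H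
remnant {G = G} (done empty)    = remnant-done G empty
remnant {G = G} (step v∈S rest) = remnant-step G v∈S (remnant rest)

-- Pathwidth at most one

module _ {G : Graph n} where
  open Graph G
  open PathDecomposition

  private
    largest : PathDecomposition G → ℕ
    largest D = max 0 (List.map ∣_∣ (bags D))

  ∣bag∣≤largest : ∀ D i → ∣ bag {G = G} D i ∣ ≤ largest D
  ∣bag∣≤largest D i = All.lookup (xs≤max 0 (List.map ∣_∣ (bags D))) (∈-map⁺ ∣_∣ (∈-lookup i))

  width≤⇒∣bag∣≤ : ∀ D {w} → width D ℤ.≤ suc w ⊖ 1 → ∀ i → ∣ bag D i ∣ ≤ suc w
  width≤⇒∣bag∣≤ D {w} narrow i = ℕ.≮⇒≥ λ big →
    ℤ.<⇒≱ (ℤ.⊖-monoˡ-< 1 (ℕ.<-≤-trans big (∣bag∣≤largest D i))) narrow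

  ∣bag∣≤⇒width≤ : ∀ D {w} → All.All (λ p → ∣ p ∣ ≤ w) (bags D) → width {G = G} D ℤ.≤ w ⊖ 1
  ∣bag∣≤⇒width≤ D small = ℤ.⊖-monoˡ-≤ 1 (max≤v⁺ z≤n (All.map⁺ small))

  ∣bag∣≥⇒width≥ : ∀ D {w} i → w ≤ ∣ bag D i ∣ → w ⊖ 1 ℤ.≤ width {G = G} D
  ∣bag∣≥⇒width≥ D i big = ℤ.⊖-monoˡ-≤ 1 (ℕ.≤-trans big (∣bag∣≤largest D i))

  width≥-1 : ∀ D → 0 ⊖ 1 ℤ.≤ width {G = G} D
  width≥-1 D = ℤ.⊖-monoˡ-≤ 1 {0} {largest D} z≤n

-- Adjacency is symmetric, so `meet` holds both ways round and the intervals of adjacent vertices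
-- intersect, namely at the larger of the two starts.
module Intervals (G : Graph n) (N : ℕ) (start end : Fin n → ℕ)
  (start≤end : ∀ v → start v ≤ end v) (end<N : ∀ v → end v < N)
  (meet : ∀ {u v} → Graph._~_ G u v → start u ≤ end v) where
  open Graph G

  Covers : ℕ → Fin n → Set
  Covers t v = start v ≤ t × t ≤ end v

  covers? : ∀ t v → Dec (Covers t v)
  covers? t v = (start v ℕ.≤? t) ×-dec (t ℕ.≤? end v)

  slice : ℕ → Subset n
  slice t = tabulate (λ v → does (covers? t v))

  slices : List (Subset n)
  slices = applyUpTo slice N

  at : ∀ {t} → t < N → Fin (length slices)
  at t<N = Fin.fromℕ< (subst (_ <_) (sym (List.length-applyUpTo slice N)) t<N)

  ∈-slices⁺ : ∀ i {v} → Covers (toℕ i) v → v ∈ List.lookup slices i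
  ∈-slices⁺ i c = subst (_ ∈_) (sym (List.lookup-applyUpTo slice N i)) (∈-tabulate⁺ (covers? (toℕ i)) c)

  ∈-slices⁻ : ∀ i {v} → v ∈ List.lookup slices i → Covers (toℕ i) v
  ∈-slices⁻ i v∈ = ∈-tabulate⁻ (covers? (toℕ i)) (subst (_ ∈_) (List.lookup-applyUpTo slice N i) v∈)

  ∈-at : ∀ {t v} (t<N : t < N) → Covers t v → v ∈ List.lookup slices (at t<N)
  ∈-at {v = v} t<N c = ∈-slices⁺ (at t<N) (subst (λ s → Covers s v) (sym (Fin.toℕ-fromℕ< _)) c)

  decomposition : PathDecomposition G
  decomposition = record
    { bags           = slices
    ; coversVertices = λ v → at (end<N v) , ∈-at (end<N v) (start≤end v , ℕ.≤-refl)
    ; coversEdges    = λ u v u~v →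
        let t<N = ℕ.⊔-lub (ℕ.≤-<-trans (start≤end u) (end<N u)) (ℕ.≤-<-trans (start≤end v) (end<N v)) in
        at t<N , ∈-at t<N (ℕ.m≤m⊔n _ _ , ℕ.⊔-lub (start≤end u) (meet (~-sym u~v)))
               , ∈-at t<N (ℕ.m≤n⊔m _ _ , ℕ.⊔-lub (meet u~v) (start≤end v))
    ; interpolates   = λ i l j i≤l l≤j v∈ →
        let v∈i , v∈j = x∈p∩q⁻ _ _ v∈
            s≤i , _   = ∈-slices⁻ i v∈i
            _   , j≤e = ∈-slices⁻ j v∈j
        in ∈-slices⁺ l (ℕ.≤-trans s≤i i≤l , ℕ.≤-trans l≤j j≤e)
    }

  narrow : ∀ {w} → (∀ t → ∣ slice t ∣ ≤ w) → PathDecomposition.width decomposition ℤ.≤ w ⊖ 1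
  narrow small = ∣bag∣≤⇒width≤ decomposition (All.applyUpTo⁺₂ slice N small)

module _ (G : Graph n) where
  open Graph G
  open PathDecomposition

  pathwidth≤1⇒decomposition : PathwidthAtMost G (ℤ.+ 1) → ∃[ D ] width {G = G} D ℤ.≤ ℤ.+ 1
  pathwidth≤1⇒decomposition (w , pw , w≤1) with D , refl ← IsPathwidth.attained pw = D , w≤1

  optimal : ∀ {b} (D : PathDecomposition G) → (∀ D′ → width D ℤ.≤ width {G = G} D′) → width D ℤ.≤ b → PathwidthAtMost G b
  optimal D best small = width D , record { attained = D , refl ; minimal = best } , small

  edge⇒width≥1 : ∀ {u v} → u ~ v → ∀ D → ℤ.+ 1 ℤ.≤ width {G = G} D
  edge⇒width≥1 {u} {v} u~v D with i , u∈ , v∈ ← coversEdges D u v u~v =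
    ∣bag∣≥⇒width≥ D {2} i (distinct₂⇒2≤∣p∣ u∈ v∈ (λ u≡v → ~-irrefl u≡v u~v))

  vertex⇒width≥0 : Fin n → ∀ D → ℤ.+ 0 ℤ.≤ width {G = G} D
  vertex⇒width≥0 v D with i , v∈ ← coversVertices D v =
    ∣bag∣≥⇒width≥ D {1} i (ℕ.≤-trans (s≤s z≤n) (x∈p⇒∣p-x∣<∣p∣ v∈))

  -- The pathwidth is a minimum that has to be attained, so an optimal decomposition must be
  -- exhibited. If there is an edge, `D` is optimal; otherwise one-point intervals at distinct times
  -- are.
  decomposition⇒pathwidth≤1 : ∀ D → width {G = G} D ℤ.≤ ℤ.+ 1 → PathwidthAtMost G (ℤ.+ 1)
  decomposition⇒pathwidth≤1 D D≤1 with Fin.any? (λ u → Fin.any? (u ~?_))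
  ... | yes (u , v , u~v) = optimal D (λ D′ → ℤ.≤-trans D≤1 (edge⇒width≥1 u~v D′)) D≤1
  ... | no edgeless = optimal I.decomposition minimal (ℤ.≤-trans (I.narrow {1} slice≤1) (ℤ.+≤+ z≤n))
    where
    module I = Intervals G n toℕ toℕ (λ _ → ℕ.≤-refl) Fin.toℕ<n (λ {u} {v} u~v → contradiction (u , v , u~v) edgeless)
    slice≤1 : ∀ t → ∣ I.slice t ∣ ≤ 1
    slice≤1 t = ∣∣-injection (I.slice t) (⊤ {1}) (const zero) (const ∈⊤) λ u∈ v∈ _ →
      let u≤t , t≤u = ∈-tabulate⁻ (I.covers? t) u∈
          v≤t , t≤v = ∈-tabulate⁻ (I.covers? t) v∈
      in Fin.toℕ-injective (trans (ℕ.≤-antisym u≤t t≤u) (ℕ.≤-antisym t≤v v≤t))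
    minimal : ∀ D → width I.decomposition ℤ.≤ width {G = G} D
    -- The trivially true predicate asks whether there is a vertex at all; this separates width 0
    -- from width -1.
    minimal D with Fin.any? (λ (v : Fin n) → v Fin.≟ v)
    ... | yes (v , _) = ℤ.≤-trans (I.narrow {1} slice≤1) (vertex⇒width≥0 v D)
    ... | no empty    = ℤ.≤-trans (I.narrow {0} λ t → ∣∣-injection (I.slice t) (⊤ {0}) (λ v → contradiction (v , refl) empty)
                                    (λ {v} _ → contradiction (v , refl) empty) (λ {v} _ → contradiction (v , refl) empty))
                                  (width≥-1 D)

-- A graph has a layout iff it is a linear forest: the components can be laid
-- out one after another.

record Layout (G : Graph n) : Set where
  open Graph G
  field
    key           : Fin n → ℕ
    key-injective : ∀ {u v} → key u ≡ key v → u ≡ v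
    gapless       : ∀ {u v} → u ~ v → key u < key v → ∀ w → key u < key w → ¬ key w < key v

-- Ordering the vertices of degree at least two by the first bag containing them
-- leaves no such vertex between two adjacent ones: its bags would all lie
-- before the first common bag of the two, hence all contain the smaller one.

module FirstBag {H : Graph n} (D : PathDecomposition H) (∣bag∣≤2 : ∀ i → ∣ PathDecomposition.bag D i ∣ ≤ 2) where
  open Graph H
  open PathDecomposition D

  ∈bag? : ∀ v i → Dec (v ∈ bag i)
  ∈bag? v i = v ∈? bag i

  first : Fin n → Fin (length bags)
  first v = proj₁ (least (∈bag? v) (coversVertices v))

  ∈-first : ∀ v → v ∈ bag (first v)
  ∈-first v = proj₁ (proj₂ (least (∈bag? v) (coversVertices v)))

  first-least : ∀ v i → v ∈ bag i → first v Fin.≤ i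
  first-least v = proj₂ (proj₂ (least (∈bag? v) (coversVertices v)))

  between : ∀ {v i l j} → v ∈ bag i → v ∈ bag j → i Fin.≤ l → l Fin.≤ j → v ∈ bag l
  between {i = i} {l} {j} v∈i v∈j i≤l l≤j = interpolates i l j i≤l l≤j (x∈p∩q⁺ (v∈i , v∈j))

  crowded : ∀ {i u v w} → u ∈ bag i → v ∈ bag i → w ∈ bag i → u ≢ v → u ≢ w → v ≡ w
  crowded {i} {v = v} {w} u∈ v∈ w∈ u≢v u≢w = decidable-stable (v Fin.≟ w) λ v≢w →
    ℕ.<⇒≱ (distinct₃⇒3≤∣p∣ u∈ v∈ w∈ u≢v u≢w v≢w) (∣bag∣≤2 i)

  -- A bag containing `w` also contains `u` and has no room for a third vertex, so every edge at `w`
  -- leads to `u`.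
  nested⇒thin : ∀ {w u} → w ≢ u → (∀ i → w ∈ bag i → u ∈ bag i) → Thin H w
  nested⇒thin {w} {u} w≢u nested x y w~x w~y = trans (only w~x) (sym (only w~y))
    where
    only : ∀ {x} → w ~ x → x ≡ u
    only {x} w~x with i , w∈ , x∈ ← coversEdges w x w~x =
      crowded w∈ x∈ (nested i w∈) (λ w≡x → ~-irrefl w≡x w~x) w≢u

  -- The bags of a vertex form an interval. Two intervals with the same left end are nested, and the
  -- vertex of the inner one is thin.
  first-injective : ∀ {u v} → ¬ Thin H u → ¬ Thin H v → first u ≡ first v → u ≡ v
  first-injective {u} {v} ¬tu ¬tv eq = decidable-stable (u Fin.≟ v) λ u≢v → nested u≢v (distinct u≢v)
    where
    nested : u ≢ v → ¬ (∀ i → u ∈ bag i → v ∈ bag i)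
    nested u≢v sub = ¬tu (nested⇒thin u≢v sub)
    distinct : u ≢ v → ∀ i → u ∈ bag i → v ∈ bag i
    distinct u≢v i u∈i = decidable-stable (v ∈? bag i) λ v∉i →
      ¬tv (nested⇒thin (u≢v ∘ sym) λ j v∈j →
        between (subst (λ k → u ∈ bag k) eq (∈-first u)) u∈i (first-least v j v∈j)
          (ℕ.≮⇒≥ λ i<j → v∉i (between (∈-first v) v∈j (subst (Fin._≤ i) eq (first-least u i u∈i)) (ℕ.<⇒≤ i<j))))

  first-gapless : ∀ {u v w} → u ~ v → ¬ Thin H w → first u Fin.< first w → ¬ first w Fin.< first v
  first-gapless {u} {v} {w} u~v ¬tw u<w w<v with b , u∈b , v∈b ← coversEdges u v u~v =
    ¬tw (nested⇒thin w≢u λ j w∈j → between (∈-first u) u∈b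
      (ℕ.≤-trans (ℕ.<⇒≤ u<w) (first-least w j w∈j))
      -- A bag of `w` after `b` would bring `u`, `v` and `w` together in the first bag of `v`.
      (ℕ.≮⇒≥ λ b<j → w≢v (sym (crowded u∈v (∈-first v) (w∈v (ℕ.≤-trans v≤b (ℕ.<⇒≤ b<j)) w∈j) u≢v (w≢u ∘ sym)))))
    where
    u≢v : u ≢ v
    u≢v u≡v = ~-irrefl u≡v u~v
    w≢u : w ≢ u
    w≢u refl = ℕ.<-irrefl refl u<w
    w≢v : w ≢ v
    w≢v refl = ℕ.<-irrefl refl w<v
    v≤b : first v Fin.≤ b
    v≤b = first-least v b v∈b
    u∈v : u ∈ bag (first v)
    u∈v = between (∈-first u) u∈b (ℕ.<⇒≤ (ℕ.<-trans u<w w<v)) v≤b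
    w∈v : ∀ {j} → first v Fin.≤ j → w ∈ bag j → w ∈ bag (first v)
    w∈v v≤j w∈j = between (∈-first w) w∈j (ℕ.<⇒≤ w<v) v≤j

  -- Thin vertices are isolated in the core and go to the end.
  place : ∀ v → Dec (Thin H v) → ℕ
  place v (yes _) = length bags + toℕ v
  place v (no _)  = toℕ (first v)

  place-injective : ∀ {u v} tu tv → place u tu ≡ place v tv → u ≡ v
  place-injective (yes _)  (yes _)  eq = Fin.toℕ-injective (ℕ.+-cancelˡ-≡ (length bags) _ _ eq)
  place-injective (yes _)  (no _)   eq = contradiction (subst (_< length bags) (sym eq) (Fin.toℕ<n _)) (ℕ.m+n≮m _ _)
  place-injective (no _)   (yes _)  eq = contradiction (subst (_< length bags) eq (Fin.toℕ<n _)) (ℕ.m+n≮m _ _)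
  place-injective (no ¬tu) (no ¬tv) eq = first-injective ¬tu ¬tv (Fin.toℕ-injective eq)

  place-gapless : ∀ {u v w} tu tv tw → u ~ v × ¬ Thin H u × ¬ Thin H v →
    place u tu < place w tw → ¬ place w tw < place v tv
  place-gapless (yes tu) _        _        (_ , ¬tu , _)   _   _   = ¬tu tu
  place-gapless (no _)   (yes tv) _        (_ , _ , ¬tv)   _   _   = ¬tv tv
  place-gapless (no _)   (no _)   (yes _)  _               _   w<v = ℕ.m+n≮m _ _ (ℕ.<-trans w<v (Fin.toℕ<n _))
  place-gapless (no _)   (no _)   (no ¬tw) (u~v , _ , _)   u<w w<v = first-gapless u~v ¬tw u<w w<v

  layout : Layout (core H)
  layout = record
    { key           = λ v → place v (thin? H v)
    ; key-injective = λ {u} {v} → place-injective (thin? H u) (thin? H v)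
    ; gapless       = λ {u} {v} e _ w → place-gapless (thin? H u) (thin? H v) (thin? H w) e
    }

-- Stronger than a layout, so that the blocks built from adjacent vertices touch. Gaps are allowed,
-- which lets components be placed far apart.
record Arrangement (G : Graph n) : Set where
  open Graph G
  field
    pos           : Fin n → ℕ
    size          : ℕ
    pos<size      : ∀ v → pos v < size
    pos-injective : ∀ {u v} → pos u ≡ pos v → u ≡ v
    consecutive   : ∀ {u v} → u ~ v → pos v ≡ suc (pos u) ⊎ pos u ≡ suc (pos v)

-- Vertices without a host occupy one block of length suc n each, sharing
-- its endpoint with the next block; the others are thin and occupy a single
-- point inside the block of their only neighbour.

module Caterpillar (H : Graph n) (A : Arrangement (core H)) where
  open Graph H
  open Arrangement A

  -- The comparison `u Fin.< v` breaks the tie on an isolated edge: both ends are thin, and only the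
  -- larger one is hosted.
  Host : Fin n → Fin n → Set
  Host v u = Thin H v × v ~ u × (¬ Thin H u ⊎ u Fin.< v)

  host? : ∀ v → Dec (∃[ u ] Host v u)
  host? v = Fin.any? λ u → thin? H v ×-dec (v ~? u) ×-dec (¬? (thin? H u) ⊎-dec (u Fin.<? v))

  -- Hosts must occupy blocks. If a thin `u` hosts `v` and is itself hosted by `w`, thinness gives
  -- `w ≡ v`, and the two tie-breaks contradict each other.
  host-hostless : ∀ {v u w} → Host v u → ¬ Host u w
  host-hostless         (tv , v~u , inj₁ ¬tu) (tu , _   , _)        = ¬tu tu
  host-hostless         (tv , v~u , inj₂ u<v) (tu , u~w , inj₁ ¬tw) = ¬tw (subst (Thin H) (tu _ _ (~-sym v~u) u~w) tv)
  host-hostless {v} {u} (tv , v~u , inj₂ u<v) (tu , u~w , inj₂ w<u) =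
    ℕ.<-asym u<v (subst (Fin._< u) (tu _ _ u~w (~-sym v~u)) w<u)

  -- Length `suc n` leaves `n` interior points, a separate one for each vertex that may be hosted.
  block : ℕ → ℕ
  block a = a * suc n

  start : ∀ v → Dec (∃[ u ] Host v u) → ℕ
  start v (yes (u , _)) = block (pos u) + suc (toℕ v)
  start v (no _)        = block (pos v)

  end : ∀ v → Dec (∃[ u ] Host v u) → ℕ
  end v (yes (u , _)) = block (pos u) + suc (toℕ v)
  end v (no _)        = block (pos v) + suc n

  start≤end : ∀ v d → start v d ≤ end v d
  start≤end v (yes _) = ℕ.≤-refl
  start≤end v (no _)  = ℕ.m≤m+n _ _

  inner< : ∀ a (v : Fin n) → block a + suc (toℕ v) < block a + suc n
  inner< a v = ℕ.+-monoʳ-< (block a) (s≤s (Fin.toℕ<n v))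

  block≤ : ∀ {a b} → a < b → block a + suc n ≤ block b
  block≤ {a} {b} a<b = subst (_≤ block b) (ℕ.+-comm (suc n) (block a)) (ℕ.*-monoˡ-≤ (suc n) a<b)

  end≤ : ∀ v d → end v d ≤ block size
  end≤ v (yes (u , _)) = ℕ.≤-trans (ℕ.<⇒≤ (inner< (pos u) v)) (block≤ (pos<size u))
  end≤ v (no _)        = block≤ (pos<size v)

  -- Applied to both ends, it puts an edge between two block vertices into the core: a thin end
  -- would be hosted by a non-thin one, and of two thin ends the larger would be hosted.
  hostless : ∀ {u v} → u ~ v → ¬ (∃[ w ] Host u w) → ¬ (∃[ w ] Host v w) → ¬ Thin H u
  hostless {u} {v} u~v ¬hu ¬hv tu = ¬hu (v , tu , u~v , inj₁ λ tv → decide tv (Fin.<-cmp u v))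
    where
    decide : Thin H v → ¬ Tri (u Fin.< v) (u ≡ v) (v Fin.< u)
    decide tv (tri< u<v _ _) = ¬hv (u , tv , ~-sym u~v , inj₂ u<v)
    decide tv (tri≈ _ u≡v _) = ~-irrefl u≡v u~v
    decide tv (tri> _ _ v<u) = ¬hu (v , tu , u~v , inj₂ v<u)

  meet : ∀ {u v} du dv → u ~ v → start u du ≤ end v dv
  meet (yes (x , tu , u~x , s)) (yes (y , hv)) u~v with refl ← tu _ _ u~x u~v = contradiction hv (host-hostless (tu , u~x , s))
  meet {u} (yes (x , tu , u~x , _)) (no _) u~v with refl ← tu _ _ u~x u~v = ℕ.<⇒≤ (inner< (pos x) u)
  meet (no _) (yes (y , tv , v~y , _)) u~v with refl ← tv _ _ v~y (~-sym u~v) = ℕ.m≤m+n _ _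
  meet {u} {v} (no ¬hu) (no ¬hv) u~v
    with consecutive (u~v , hostless u~v ¬hu ¬hv , hostless (~-sym u~v) ¬hv ¬hu)
  ... | inj₁ eq rewrite eq = ℕ.≤-trans (ℕ.m≤n+m _ (suc n)) (ℕ.m≤m+n _ _)
  -- The two blocks share just this point, which is why a block includes its right endpoint.
  ... | inj₂ eq rewrite eq = ℕ.≤-reflexive (ℕ.+-comm (suc n) _)

  module I = Intervals H (suc (block size)) (λ v → start v (host? v)) (λ v → end v (host? v))
    (λ v → start≤end v (host? v)) (λ v → s≤s (end≤ v (host? v))) (λ {u} {v} → meet (host? u) (host? v))

  same-block : ∀ {a b t} → block a ≤ t → t < block a + suc n → block b ≤ t → t < block b + suc n → a ≡ b
  same-block {a} {b} a≤t t<a b≤t t<b with ℕ.<-cmp a b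
  ... | tri< a<b _ _ = contradiction (ℕ.<-≤-trans t<a (ℕ.≤-trans (block≤ a<b) b≤t)) (ℕ.<-irrefl refl)
  ... | tri≈ _ a≡b _ = a≡b
  ... | tri> _ _ b<a = contradiction (ℕ.<-≤-trans t<b (ℕ.≤-trans (block≤ b<a) a≤t)) (ℕ.<-irrefl refl)

  endpoint : ∀ {a t} → t ≤ block a + suc n → ¬ t < block a + suc n → t ≡ block (suc a)
  endpoint {a} t≤ t≮ = trans (ℕ.≤-antisym t≤ (ℕ.≮⇒≥ t≮)) (ℕ.+-comm (block a) (suc n))

  inner≢endpoint : ∀ {a b t} (v : Fin n) → block a + suc (toℕ v) ≤ t → t ≤ block a + suc (toℕ v) → t ≢ block b
  inner≢endpoint {a} {b} {t} v s e refl
    with refl ← same-block {a} {b} {t} (ℕ.m+n≤o⇒m≤o _ s) (ℕ.≤-<-trans e (inner< a v)) ℕ.≤-refl (ℕ.m<m+n _ (s≤s z≤n))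
    = ℕ.m+1+n≰m _ s

  inner-injective : ∀ {a b t} (u v : Fin n) → block a + suc (toℕ u) ≤ t → t ≤ block a + suc (toℕ u) →
    block b + suc (toℕ v) ≤ t → t ≤ block b + suc (toℕ v) → u ≡ v
  inner-injective {a} {b} {t} u v s e s′ e′
    with refl ← same-block {a} {b} {t} (ℕ.m+n≤o⇒m≤o _ s) (ℕ.≤-<-trans e (inner< a u)) (ℕ.m+n≤o⇒m≤o _ s′) (ℕ.≤-<-trans e′ (inner< b v))
    = Fin.toℕ-injective (ℕ.suc-injective (ℕ.+-cancelˡ-≡ (block a) _ _ (trans (ℕ.≤-antisym s e) (ℕ.≤-antisym e′ s′))))

  -- A slice contains at most one block other than by its right endpoint, and
  -- at most one further vertex.
  colour : ℕ → ∀ v → Dec (∃[ u ] Host v u) → Fin 2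
  colour t v (yes _) = suc zero
  colour t v (no _) with t ℕ.<? block (pos v) + suc n
  ... | yes _ = zero
  ... | no _  = suc zero

  -- A hosted vertex and a block of colour `suc zero` do not clash: the former is met at an interior
  -- point, the latter only at its right endpoint, a multiple of `suc n`.
  colour-injective : ∀ {t u v} du dv → start u du ≤ t × t ≤ end u du → start v dv ≤ t × t ≤ end v dv →
    colour t u du ≡ colour t v dv → u ≡ v
  colour-injective {u = u} {v} (yes (x , _)) (yes (y , _)) (s , e) (s′ , e′) _ =
    inner-injective {pos x} {pos y} u v s e s′ e′
  colour-injective {t} {u} {v} (yes (x , _)) (no _) (s , e) (s′ , e′) eq with t ℕ.<? block (pos v) + suc n
  ... | no t≮v = contradiction (endpoint {pos v} e′ t≮v) (inner≢endpoint {pos x} {suc (pos v)} u s e)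
  colour-injective {t} {u} {v} (no _) (yes (y , _)) (s , e) (s′ , e′) eq with t ℕ.<? block (pos u) + suc n
  ... | no t≮u = contradiction (endpoint {pos u} e t≮u) (inner≢endpoint {pos y} {suc (pos u)} v s′ e′)
  colour-injective {t} {u} {v} (no _) (no _) (s , e) (s′ , e′) eq
    with t ℕ.<? block (pos u) + suc n | t ℕ.<? block (pos v) + suc n
  ... | yes t<u | yes t<v = pos-injective (same-block s t<u s′ t<v)
  ... | no t≮u  | no t≮v  = pos-injective (ℕ.suc-injective (ℕ.*-cancelʳ-≡ _ _ (suc n) (trans (sym (endpoint {pos u} e t≮u)) (endpoint {pos v} e′ t≮v))))

  slice≤2 : ∀ t → ∣ I.slice t ∣ ≤ 2
  slice≤2 t = ∣∣-injection (I.slice t) (⊤ {2}) (λ v → colour t v (host? v)) (λ _ → ∈⊤)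
    λ {u} {v} u∈ v∈ → colour-injective (host? u) (host? v) (∈-tabulate⁻ (I.covers? t) u∈) (∈-tabulate⁻ (I.covers? t) v∈)

  narrow : PathDecomposition.width I.decomposition ℤ.≤ ℤ.+ 1
  narrow = I.narrow {2} slice≤2

pathwidth≤1⇒layout : (H : Graph n) → PathwidthAtMost H (ℤ.+ 1) → Layout (core H)
pathwidth≤1⇒layout H pw with D , D≤1 ← pathwidth≤1⇒decomposition H pw =
  FirstBag.layout D (width≤⇒∣bag∣≤ D D≤1)

arrangement⇒pathwidth≤1 : (H : Graph n) → Arrangement (core H) → PathwidthAtMost H (ℤ.+ 1)
arrangement⇒pathwidth≤1 H A = decomposition⇒pathwidth≤1 H I.decomposition narrow
  where open Caterpillar H A

-- Linear forests

module _ {G : Graph n} (L : Layout G) where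
  open Graph G
  open Layout L

  -- A discrete intermediate value argument: the walk starts at or below level `c` and ends above
  -- it.
  crossing : ∀ {a b} → Star _~_ a b → ∀ {c} → key a ≤ c → c < key b →
    ∃[ s ] ∃[ t ] (Star _~_ a s × s ~ t × key s ≤ c × c < key t)
  crossing ε a≤c c<b = contradiction a≤c (ℕ.<⇒≱ c<b)
  crossing (_◅_ {j = x} a~x x⟶b) {c} a≤c c<b with key x ℕ.≤? c
  ... | no x≰c  = _ , x , ε , a~x , a≤c , ℕ.≰⇒> x≰c
  ... | yes x≤c with s , t , x⟶s , rest ← crossing x⟶b x≤c c<b = s , t , a~x ◅ x⟶s , rest

  module _ {C : Subset n} (component : IsComponent G C) where
    private
      root = proj₁ component

    connected : ∀ {u v} → u ∈ C → v ∈ C → Star _~_ u v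
    connected u∈C v∈C = reverse ~-sym (to (proj₂ component _) u∈C) ◅◅ to (proj₂ component _) v∈C

    closed : ∀ {u v} → u ∈ C → Star _~_ u v → v ∈ C
    closed u∈C u⟶v = from (proj₂ component _) (to (proj₂ component _) u∈C ◅◅ u⟶v)

    -- A walk from u to v has an edge st with key s ≤ key u < key t, and
    -- there is no room for s and t other than being u and v.
    next⇒adjacent : ∀ {u v} → u ∈ C → v ∈ C → key u < key v →
      (∀ w → w ∈ C → key u < key w → ¬ key w < key v) → u ~ v
    next⇒adjacent {u} {v} u∈C v∈C u<v empty
      with s , t , u⟶s , s~t , s≤u , u<t ← crossing (connected u∈C v∈C) ℕ.≤-refl u<v
      = subst₂ _~_ (key-injective s≡u) (key-injective t≡v) s~t
      where
      s<t : key s < key t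
      s<t = ℕ.≤-<-trans s≤u u<t
      v≤t : key v ≤ key t
      v≤t = ℕ.≮⇒≥ (empty t (closed u∈C (u⟶s ◅◅ (s~t ◅ ε))) u<t)
      s≡u : key s ≡ key u
      s≡u = ℕ.≤-antisym s≤u (ℕ.≮⇒≥ λ s<u → gapless s~t s<t u s<u u<t)
      t≡v : key t ≡ key v
      t≡v = ℕ.≤-antisym (ℕ.≮⇒≥ λ v<t → gapless s~t s<t v (ℕ.≤-<-trans s≤u u<v) v<t) v≤t

    open Sorting {order C} (λ i → key (nth C i)) (λ eq → nth-injective C (key-injective eq))

    succ⇒adjacent : ∀ i j → toℕ (rank j) ≡ suc (toℕ (rank i)) → nth C i ~ nth C j
    succ⇒adjacent i j eq = next⇒adjacent (nth-∈ C i) (nth-∈ C j) (rank-cancel (ℕ.≤-reflexive (sym eq))) λ w w∈ i<w w<j →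
      let k      = index C w∈
          key-k  = cong key (nth-index C w∈)
          i<k    = rank-mono {i} {k} (subst (key (nth C i) <_) (sym key-k) i<w)
          k<j    = rank-mono {k} {j} (subst (_< key (nth C j)) (sym key-k) w<j)
      in ℕ.<⇒≱ i<k (ℕ.≤-pred (subst (_ <_) eq k<j))

    -- A jump in rank would be filled by the vertex `k` of the intermediate rank, whose key
    -- `gapless` forbids.
    adjacent⇒succ : ∀ i j → nth C i ~ nth C j → key (nth C i) < key (nth C j) → toℕ (rank j) ≡ suc (toℕ (rank i))
    adjacent⇒succ i j i~j i<j = ℕ.≤-antisym (ℕ.≮⇒≥ room) (rank-mono i<j)
      where
      room : ¬ suc (toℕ (rank i)) < toℕ (rank j)
      room gap = gapless i~j i<j (nth C k) (rank-cancel (ℕ.≤-reflexive (sym rank-k))) (rank-cancel (subst (_< _) (sym rank-k) gap))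
        where
        bound = ℕ.<-trans gap (Fin.toℕ<n (rank j))
        k = unrank (Fin.fromℕ< bound)
        rank-k : toℕ (rank k) ≡ suc (toℕ (rank i))
        rank-k = trans (cong toℕ (rank-unrank _)) (Fin.toℕ-fromℕ< bound)

    component-isPath : IsPath (G [ C ])
    component-isPath = rank-↔ , λ i j → mk⇔ (adjacent i j)
      [ succ⇒adjacent i j , (λ eq → ~-sym (succ⇒adjacent j i eq)) ]′
      where
      adjacent : ∀ i j → nth C i ~ nth C j → Consecutive (rank i) (rank j)
      adjacent i j i~j with ℕ.<-cmp (key (nth C i)) (key (nth C j))
      ... | tri< i<j _ _ = inj₁ (adjacent⇒succ i j i~j i<j)
      ... | tri≈ _ eq _  = contradiction i~j (~-irrefl (key-injective eq))
      ... | tri> _ _ j<i = inj₂ (adjacent⇒succ j i (~-sym i~j) j<i)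

layout⇒linearForest : {G : Graph n} → Layout G → LinearForest G
layout⇒linearForest L C component = component-isPath L component

-- Through k u v: some walk from u to v has all its inner vertices below k
-- (Floyd-Warshall).

module _ (G : Graph n) where
  open Graph G

  Through : ∀ k → k ≤ n → Rel (Fin n) 0ℓ
  Through zero    _   u v = u ≡ v ⊎ u ~ v
  Through (suc k) k<n u v = Through k (ℕ.<⇒≤ k<n) u v ⊎
    (Through k (ℕ.<⇒≤ k<n) u (Fin.fromℕ< k<n) × Through k (ℕ.<⇒≤ k<n) (Fin.fromℕ< k<n) v)

  through? : ∀ k k≤n → Binary.Decidable (Through k k≤n)
  through? zero    _   u v = (u Fin.≟ v) ⊎-dec (u ~? v)
  through? (suc k) k<n u v = through? k _ u v ⊎-dec (through? k _ u _ ×-dec through? k _ _ v)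

  through⇒star : ∀ k k≤n {u v} → Through k k≤n u v → Star _~_ u v
  through⇒star zero    _   (inj₁ refl)    = ε
  through⇒star zero    _   (inj₂ u~v)     = u~v ◅ ε
  through⇒star (suc k) k<n (inj₁ p)       = through⇒star k _ p
  through⇒star (suc k) k<n (inj₂ (p , q)) = through⇒star k _ p ◅◅ through⇒star k _ q

  through-trans : ∀ k k≤n {u w v} → toℕ w < k → Through k k≤n u w → Through k k≤n w v → Through k k≤n u v
  through-trans (suc k) k<n {u} {w} {v} w<1+k p q with toℕ w ℕ.≟ k
  ... | yes w≡k with refl ← Fin.toℕ-injective {i = w} {Fin.fromℕ< k<n} (trans w≡k (sym (Fin.toℕ-fromℕ< k<n)))
    = inj₂ ([ (λ x → x) , proj₁ ]′ p , [ (λ x → x) , proj₂ ]′ q)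
  ... | no w≢k with ℕ.≤∧≢⇒< (ℕ.≤-pred w<1+k) w≢k
  ...   | w<k with p | q
  ...     | inj₁ uw        | inj₁ wv        = inj₁ (through-trans k _ w<k uw wv)
  ...     | inj₁ uw        | inj₂ (wk , kv) = inj₂ (through-trans k _ w<k uw wk , kv)
  ...     | inj₂ (uk , kw) | inj₁ wv        = inj₂ (uk , through-trans k _ w<k kw wv)
  -- Both walks visit the vertex numbered `k`; the detour through `w` between the two visits is cut
  -- out.
  ...     | inj₂ (uk , _)  | inj₂ (_ , kv)  = inj₂ (uk , kv)

  edge⇒through : ∀ k k≤n {u v} → u ≡ v ⊎ u ~ v → Through k k≤n u v
  edge⇒through zero    _   e = e
  edge⇒through (suc k) k<n e = inj₁ (edge⇒through k _ e)

  star⇒through : ∀ {u v} → Star _~_ u v → Through n ℕ.≤-refl u v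
  star⇒through ε         = edge⇒through n _ (inj₁ refl)
  star⇒through (e ◅ w⟶v) = through-trans n _ (Fin.toℕ<n _) (edge⇒through n _ (inj₂ e)) (star⇒through w⟶v)

  -- `LinearForest` can only be applied to a component given as a `Subset`, a Boolean vector, so
  -- reachability has to be decided.
  star? : Binary.Decidable (Star _~_)
  star? u v = map′ (through⇒star n _) star⇒through (through? n ℕ.≤-refl u v)

module _ {G : Graph n} (forest : LinearForest G) where
  open Graph G

  class : Fin n → Subset n
  class r = tabulate (λ u → does (star? G r u))

  class-component : ∀ r → IsComponent G (class r)
  class-component r = r , λ u → mk⇔ (∈-tabulate⁻ (star? G r)) (∈-tabulate⁺ (star? G r))

  -- A canonical representative: all vertices of a component are then placed by one and the same
  -- path isomorphism.
  leader : Fin n → Fin n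
  leader v = proj₁ (least (λ u → star? G u v) (v , ε))

  leader⟶ : ∀ v → Star _~_ (leader v) v
  leader⟶ v = proj₁ (proj₂ (least (λ u → star? G u v) (v , ε)))

  leader-≤ : ∀ {u v} → u ~ v → leader v Fin.≤ leader u
  leader-≤ {u} {v} u~v = proj₂ (proj₂ (least (λ u → star? G u v) (v , ε))) (leader u) (leader⟶ u ◅◅ (u~v ◅ ε))

  leader-cong : ∀ {u v} → u ~ v → leader u ≡ leader v
  leader-cong u~v = Fin.≤-antisym (leader-≤ (~-sym u~v)) (leader-≤ u~v)

  spot : ∀ r {v} → Star _~_ r v → Fin (order (class r))
  spot r r⟶v = Inverse.to (proj₁ (forest (class r) (class-component r))) (index (class r) (∈-tabulate⁺ (star? G r) r⟶v))

  spot-injective : ∀ r {u v} (p : Star _~_ r u) (q : Star _~_ r v) → spot r p ≡ spot r q → u ≡ v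
  spot-injective r {u} {v} p q eq = begin
    u                                        ≡⟨ nth-index (class r) u∈ ⟨
    nth (class r) (index (class r) u∈)       ≡⟨ cong (nth (class r)) (Injection.injective (↔⇒↣ (proj₁ (forest (class r) (class-component r)))) eq) ⟩
    nth (class r) (index (class r) v∈)       ≡⟨ nth-index (class r) v∈ ⟩
    v                                        ∎
    where
    open ≡-Reasoning
    u∈ = ∈-tabulate⁺ (star? G r) p
    v∈ = ∈-tabulate⁺ (star? G r) q

  spot-adjacent : ∀ r {u v} (p : Star _~_ r u) (q : Star _~_ r v) → u ~ v → Consecutive (spot r p) (spot r q)
  spot-adjacent r p q u~v = to (proj₂ (forest (class r) (class-component r)) _ _)
    (subst₂ _~_ (sym (nth-index (class r) (∈-tabulate⁺ (star? G r) p))) (sym (nth-index (class r) (∈-tabulate⁺ (star? G r) q))) u~v)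

  -- Row-major numbering of pairs: the component led by `r` gets the `n` positions from `n * toℕ r`
  -- on, enough for any path in `G`.
  place : ∀ r {v} → Star _~_ r v → Fin (n * n)
  place r p = combine r (inject≤ (spot r p) (order≤n (class r)))

  place-injective : ∀ {r s u v} (p : Star _~_ r u) (q : Star _~_ s v) → place r p ≡ place s q → u ≡ v
  place-injective {r} {s} p q eq with Fin.combine-injective r _ s _ eq
  ... | refl , eq′ = spot-injective r p q (Fin.inject≤-injective (order≤n (class r)) (order≤n (class r)) _ _ eq′)

  toℕ-place : ∀ r {v} (p : Star _~_ r v) → toℕ (place r p) ≡ n * toℕ r + toℕ (spot r p)
  toℕ-place r p = trans (Fin.toℕ-combine r _) (cong (n * toℕ r +_) (Fin.toℕ-inject≤ _ (order≤n (class r))))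

  place-succ : ∀ r {u v} (p : Star _~_ r u) (q : Star _~_ r v) →
    toℕ (spot r q) ≡ suc (toℕ (spot r p)) → toℕ (place r q) ≡ suc (toℕ (place r p))
  place-succ r p q eq = begin
    toℕ (place r q)                        ≡⟨ toℕ-place r q ⟩
    n * toℕ r + toℕ (spot r q)             ≡⟨ cong (n * toℕ r +_) eq ⟩
    n * toℕ r + suc (toℕ (spot r p))       ≡⟨ ℕ.+-suc _ _ ⟩
    suc (n * toℕ r + toℕ (spot r p))       ≡⟨ cong suc (toℕ-place r p) ⟨
    suc (toℕ (place r p))                  ∎
    where open ≡-Reasoning

  place-adjacent : ∀ {r s u v} → r ≡ s → (p : Star _~_ r u) (q : Star _~_ s v) → u ~ v → Consecutive (place r p) (place s q)
  place-adjacent {r} refl p q u~v with spot-adjacent r p q u~v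
  ... | inj₁ eq = inj₁ (place-succ r p q eq)
  ... | inj₂ eq = inj₂ (place-succ r q p eq)

  arrangement : Arrangement G
  arrangement = record
    { pos           = λ v → toℕ (place (leader v) (leader⟶ v))
    ; size          = n * n
    ; pos<size      = λ v → Fin.toℕ<n (place (leader v) (leader⟶ v))
    ; pos-injective = λ {u} {v} eq → place-injective (leader⟶ u) (leader⟶ v) (Fin.toℕ-injective eq)
    ; consecutive   = λ {u} {v} u~v → place-adjacent (leader-cong u~v) (leader⟶ u) (leader⟶ v) u~v
    }

-- Transfer between the exploded graph and the core with `S` deleted

module _ {G : Graph n} {S : Subset n} {H : Graph m} (R : Remnant G S H) where
  open Remnant R
  private
    K = delete (core G) S

  -- Thinness is measured in `G` on the left and in `H` on the right; `ι-thin` makes the two agree,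
  -- because exploding, unlike deleting, does not lower degrees.
  core-adj : ∀ i j → Graph._~_ K i j ⇔ Graph._~_ (core H) (ι i) (ι j)
  core-adj i j = mk⇔
    (λ (e , ti , tj) → to (ι-adj i j) e , ti ∘ from (ι-thin i) , tj ∘ from (ι-thin j))
    (λ (e , ti , tj) → from (ι-adj i j) e , ti ∘ to (ι-thin i) , tj ∘ to (ι-thin j))

  restrict : Layout (core H) → Layout K
  restrict L = record
    { key           = key ∘ ι
    ; key-injective = ι-injective ∘ key-injective
    ; gapless       = λ {i} {j} e i<j w → gapless (to (core-adj i j) e) i<j (ι w)
    }
    where open Layout L

  -- A vertex that is not in the image of `ι` is thin, hence isolated in the core, and can go
  -- anywhere behind the given positions.
  extend : Arrangement K → Arrangement (core H)
  extend A = record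
    { pos           = λ x → where′ x (ι-cover x)
    ; size          = size + m
    ; pos<size      = λ x → bounded x (ι-cover x)
    ; pos-injective = λ {x} {y} → injective x y (ι-cover x) (ι-cover y)
    ; consecutive   = λ {x} {y} → adjacent x y (ι-cover x) (ι-cover y)
    }
    where
    open Arrangement A
    Cover : Fin m → Set
    Cover x = ∃[ i ] ι i ≡ x ⊎ Thin H x

    where′ : ∀ x → Cover x → ℕ
    where′ x (inj₁ (i , _)) = pos i
    where′ x (inj₂ _)       = size + toℕ x

    bounded : ∀ x c → where′ x c < size + m
    bounded x (inj₁ (i , _)) = ℕ.<-≤-trans (pos<size i) (ℕ.m≤m+n size m)
    bounded x (inj₂ _)       = ℕ.+-monoʳ-< size (Fin.toℕ<n x)

    injective : ∀ x y c d → where′ x c ≡ where′ y d → x ≡ y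
    injective x y (inj₁ (i , refl)) (inj₁ (j , refl)) eq = cong ι (pos-injective eq)
    injective x y (inj₁ (i , _))    (inj₂ _)          eq = contradiction (subst (_< size) eq (pos<size i)) (ℕ.m+n≮m _ _)
    injective x y (inj₂ _)          (inj₁ (j , _))    eq = contradiction (subst (_< size) (sym eq) (pos<size j)) (ℕ.m+n≮m _ _)
    injective x y (inj₂ _)          (inj₂ _)          eq = Fin.toℕ-injective (ℕ.+-cancelˡ-≡ size _ _ eq)

    adjacent : ∀ x y c d → Graph._~_ (core H) x y → where′ y d ≡ suc (where′ x c) ⊎ where′ x c ≡ suc (where′ y d)
    adjacent x y (inj₁ (i , refl)) (inj₁ (j , refl)) e            = consecutive (from (core-adj i j) e)
    adjacent x y (inj₂ tx)         _                 (_ , ¬tx , _) = contradiction tx ¬tx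
    adjacent x y (inj₁ _)          (inj₂ ty)         (_ , _ , ¬ty) = contradiction ty ¬ty

  pathwidth⇔linearForest : PathwidthAtMost H (ℤ.+ 1) ⇔ LinearForest K
  pathwidth⇔linearForest = mk⇔
    (λ pw → layout⇒linearForest (restrict (pathwidth≤1⇒layout H pw)))
    (λ forest → arrangement⇒pathwidth≤1 H (extend (arrangement forest)))

explosionSet⇔coPathSet : (G : Graph n) (S : Subset n) → ExplosionSet G S ⇔ CoPathSet (core G) S
explosionSet⇔coPathSet G S = mk⇔
  (λ (m , H , e , pw) → to (pathwidth⇔linearForest (remnant e)) pw)
  (λ forest → let m , H , e = explosion G S in
    m , H , e , from (pathwidth⇔linearForest (remnant e)) forest)

-- The program

Runs : Program r → Store r → ℕ → Store r → Set
Runs c σ β τ = ∃[ t ] (⟨ c , σ ⟩⇓[ t ] τ × t ≤ β)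

infixr 5 _⨟_

_⨟_ : Runs c σ β₁ σ′ → Runs d σ′ β₂ τ → Runs (c ⨾ d) σ (β₁ + β₂) τ
(_ , p , p≤) ⨟ (_ , q , q≤) = _ , (p ⨾ q) , ℕ.+-mono-≤ p≤ q≤

within : β₁ ≤ β₂ → Runs c σ β₁ τ → Runs c σ β₂ τ
within β₁≤β₂ (t , p , t≤) = t , p , ℕ.≤-trans t≤ β₁≤β₂

exactly : ∀ {t} → ⟨ c , σ ⟩⇓[ t ] τ → Runs c σ t τ
exactly p = _ , p , ℕ.≤-refl

-- The invariant `I ds ys` speaks of the items done, latest first, and the items left. An iteration
-- costs its body and one test; the final 1 is the failing test.
while-runs : {A : Set} {x : Fin r} {p : Maybe Symbol → Bool} (I : List A → List A → Store r) →
  (∀ ds y ys → p (top (I ds (y ∷ ys)) x) ≡ true) →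
  (∀ ds → p (top (I ds []) x) ≡ false) →
  (∀ ds y ys → Runs c (I ds (y ∷ ys)) β (I (y ∷ ds) ys)) →
  ∀ ds ys → Runs (whileTop x ∈ p loop c) (I ds ys) (length ys * suc β + 1) (I (ys ʳ++ ds) [])
while-runs I go stop body ds []       = 1 , while-false (stop ds) , ℕ.≤-refl
while-runs {β = β} I go stop body ds (y ∷ ys)
  with t₁ , p , t₁≤ ← body ds y ys | t₂ , q , t₂≤ ← while-runs I go stop body (y ∷ ds) ys
  = suc (t₁ + t₂) , while-true (go ds y ys) p q
  , s≤s (subst (t₁ + t₂ ≤_) (sym (ℕ.+-assoc β _ 1)) (ℕ.+-mono-≤ t₁≤ t₂≤))

is𝟎 is𝟏 isBit : Maybe Symbol → Bool
is𝟎 (just 𝟎) = true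
is𝟎 _        = false
is𝟏 (just 𝟏) = true
is𝟏 _        = false
isBit (just ♯) = false
isBit (just _) = true
isBit nothing  = false

moveBit : Fin r → Fin r → Program r
moveBit x y = (ifTop x ∈ is𝟏 then push y 𝟏 else push y 𝟎) ⨾ pop x

-- Stack 0 holds the unread input and in the end the output, stack 1 the rows
-- read so far in reverse, stacks 2 and 3 their marks, where 𝟏 stands for at
-- least two entries 𝟏. While a row is read, 𝟎, ♯ and 𝟏 on top of stack 2
-- stand for no, one and several entries 𝟏.

scanBit scanRow copyBit copyRow coreProgram : Program 5
scanBit =
  (ifTop 0F ∈ is𝟏
    then (push 1F 𝟏 ⨾ (ifTop 2F ∈ is𝟎 then (pop 2F ⨾ push 2F ♯) else (pop 2F ⨾ push 2F 𝟏)))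
    else push 1F 𝟎) ⨾
  pop 0F
scanRow =
  push 2F 𝟎 ⨾
  (whileTop 0F ∈ isBit loop scanBit) ⨾
  pop 0F ⨾
  push 1F ♯ ⨾
  (ifTop 2F ∈ is𝟏 then push 3F 𝟏 else (push 3F 𝟎 ⨾ pop 2F ⨾ push 2F 𝟎))
copyBit =
  (ifTop 1F ∈ is𝟏
    then (ifTop 3F ∈ is𝟏
      then (ifTop 2F ∈ is𝟏 then push 0F 𝟏 else push 0F 𝟎)
      else push 0F 𝟎)
    else push 0F 𝟎) ⨾
  pop 1F ⨾
  moveBit 2F 4F
copyRow =
  pop 1F ⨾
  push 0F ♯ ⨾
  (whileTop 2F ∈ is-just loop copyBit) ⨾
  (whileTop 4F ∈ is-just loop moveBit 4F 2F) ⨾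
  pop 3F
coreProgram =
  (whileTop 0F ∈ isBit loop scanRow) ⨾
  (whileTop 3F ∈ is-just loop copyRow)

-- Correctness and running time of the subprograms

bump : Symbol → Symbol
bump 𝟎 = ♯
bump _ = 𝟏

-- A saturating counter. The head of the list is the bit read last, as in the list of items done of
-- `while-runs`.
tally : List Bool → Symbol
tally []           = 𝟎
tally (false ∷ bs) = tally bs
tally (true ∷ bs)  = bump (tally bs)

many : List Bool → Bool
many bs = is𝟏 (just (tally bs))

scanBit-runs : ∀ e bs {s₀ s₁ s₂ s₃ s₄} → Runs scanBit
  ((bit e ∷ s₀) ∷ s₁ ∷ (tally bs ∷ s₂) ∷ s₃ ∷ s₄ ∷ []) 6
  (s₀ ∷ (bit e ∷ s₁) ∷ (tally (e ∷ bs) ∷ s₂) ∷ s₃ ∷ s₄ ∷ [])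
scanBit-runs false bs = within (ℕ.≤ᵇ⇒≤ 3 6 tt) (exactly (if-false refl push ⨾ pop))
scanBit-runs true  bs with tally bs
... | 𝟎 = exactly (if-true refl (push ⨾ if-true refl (pop ⨾ push)) ⨾ pop)
... | 𝟏 = exactly (if-true refl (push ⨾ if-false refl (pop ⨾ push)) ⨾ pop)
... | ♯ = exactly (if-true refl (push ⨾ if-false refl (pop ⨾ push)) ⨾ pop)

-- The marks are kept twice: those on stack 3 are used up one per row, while those on stack 2 are
-- traversed for every row and restored through stack 4.
mark-runs : ∀ bs {s₀ s₁ s₂ s₃ s₄} → Runs (ifTop 2F ∈ is𝟏 then push 3F 𝟏 else (push 3F 𝟎 ⨾ pop 2F ⨾ push 2F 𝟎))
  (s₀ ∷ s₁ ∷ (tally bs ∷ s₂) ∷ s₃ ∷ s₄ ∷ []) 4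
  (s₀ ∷ s₁ ∷ (bit (many bs) ∷ s₂) ∷ (bit (many bs) ∷ s₃) ∷ s₄ ∷ [])
mark-runs bs with tally bs
... | 𝟎 = exactly (if-false refl (push ⨾ pop ⨾ push))
... | 𝟏 = within (ℕ.≤ᵇ⇒≤ 2 4 tt) (exactly (if-true refl push))
... | ♯ = exactly (if-false refl (push ⨾ pop ⨾ push))

isBit-bit : ∀ e → isBit (just (bit e)) ≡ true
isBit-bit false = refl
isBit-bit true  = refl

scanRow-runs : ∀ bs {s₀ s₁ s₂ s₃ s₄} → Runs scanRow
  ((map bit bs ++ ♯ ∷ s₀) ∷ s₁ ∷ s₂ ∷ s₃ ∷ s₄ ∷ []) (1 + (length bs * 7 + 1 + 6))
  (s₀ ∷ (♯ ∷ map bit (bs ʳ++ []) ++ s₁) ∷ (bit (many (bs ʳ++ [])) ∷ s₂) ∷ (bit (many (bs ʳ++ [])) ∷ s₃) ∷ s₄ ∷ [])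
scanRow-runs bs {s₀} {s₁} {s₂} {s₃} {s₄} =
  exactly push ⨟
  while-runs (λ ds ys → (map bit ys ++ ♯ ∷ s₀) ∷ (map bit ds ++ s₁) ∷ (tally ds ∷ s₂) ∷ s₃ ∷ s₄ ∷ [])
    (λ _ e _ → isBit-bit e) (λ _ → refl) (λ ds e _ → scanBit-runs e ds) [] bs ⨟
  exactly pop ⨟
  exactly push ⨟
  mark-runs (bs ʳ++ [])

moveBit₂₄-runs : ∀ e {s₀ s₁ s₂ s₃ s₄} → Runs (moveBit 2F 4F)
  (s₀ ∷ s₁ ∷ (bit e ∷ s₂) ∷ s₃ ∷ s₄ ∷ []) 3 (s₀ ∷ s₁ ∷ s₂ ∷ s₃ ∷ (bit e ∷ s₄) ∷ [])
moveBit₂₄-runs true  = exactly (if-true refl push ⨾ pop)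
moveBit₂₄-runs false = exactly (if-false refl push ⨾ pop)

moveBit₄₂-runs : ∀ e {s₀ s₁ s₂ s₃ s₄} → Runs (moveBit 4F 2F)
  (s₀ ∷ s₁ ∷ s₂ ∷ s₃ ∷ (bit e ∷ s₄) ∷ []) 3 (s₀ ∷ s₁ ∷ (bit e ∷ s₂) ∷ s₃ ∷ s₄ ∷ [])
moveBit₄₂-runs true  = exactly (if-true refl push ⨾ pop)
moveBit₄₂-runs false = exactly (if-false refl push ⨾ pop)

copyBit-runs : ∀ e m m′ {s₀ s₁ s₂ s₃ s₄} → Runs copyBit
  (s₀ ∷ (bit e ∷ s₁) ∷ (bit m′ ∷ s₂) ∷ (bit m ∷ s₃) ∷ s₄ ∷ []) 8
  ((bit (e ∧ m ∧ m′) ∷ s₀) ∷ s₁ ∷ s₂ ∷ (bit m ∷ s₃) ∷ (bit m′ ∷ s₄) ∷ [])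
copyBit-runs e m m′ = entry e m m′ ⨟ exactly pop ⨟ moveBit₂₄-runs m′
  where
  entry : ∀ e m m′ {s₀ s₁ s₂ s₃ s₄} → Runs _
    (s₀ ∷ (bit e ∷ s₁) ∷ (bit m′ ∷ s₂) ∷ (bit m ∷ s₃) ∷ s₄ ∷ []) 4
    ((bit (e ∧ m ∧ m′) ∷ s₀) ∷ (bit e ∷ s₁) ∷ (bit m′ ∷ s₂) ∷ (bit m ∷ s₃) ∷ s₄ ∷ [])
  entry false m     m′    = within (ℕ.≤ᵇ⇒≤ 2 4 tt) (exactly (if-false refl push))
  entry true  false m′    = within (ℕ.≤ᵇ⇒≤ 3 4 tt) (exactly (if-true refl (if-false refl push)))
  entry true  true  false = exactly (if-true refl (if-true refl (if-false refl push)))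
  entry true  true  true  = exactly (if-true refl (if-true refl (if-true refl push)))

-- The scan reverses the order of the rows and the entries of each row; copying reverses both once
-- more.
ʳ++-involutive : {A : Set} (xs : List A) → (xs ʳ++ []) ʳ++ [] ≡ xs
ʳ++-involutive xs = trans (List.ʳ++-ʳ++ xs) (List.++-identityʳ xs)

-- By `nonempty` each row starts with a bit, so a `♯` at the start of a row can only be the end of
-- the matrix. The symbols after the matrix stay in place below the output, whatever `rest` is.
module CoreProgram {A : Set} (columns : List A) (nonempty : A → ∃[ w ] ∃[ ws ] columns ≡ w ∷ ws)
                   (entry : A → A → Bool) (rest : List Symbol) where

  row : A → List Bool
  row v = map (entry v) columns

  mark : A → Bool
  mark v = many (row v ʳ++ [])

  entry′ : A → A → Bool
  entry′ v u = entry v u ∧ mark v ∧ mark u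

  rows : (A → A → Bool) → List A → List Symbol
  rows a = foldr (λ v s → map (bit ∘ a v) columns ++ ♯ ∷ s) (♯ ∷ rest)

  stacked : List A → List Symbol
  stacked = foldr (λ v s → ♯ ∷ map bit (row v ʳ++ []) ++ s) []

  marks : List A → List Symbol
  marks = map (bit ∘ mark)

  backwards : List A
  backwards = columns ʳ++ []

  size : ℕ
  size = length columns

  size-backwards : length backwards ≡ size
  size-backwards = trans (List.length-ʳ++ columns) (ℕ.+-identityʳ size)

  scan-runs : Runs (whileTop 0F ∈ isBit loop scanRow)
    (rows entry columns ∷ [] ∷ [] ∷ [] ∷ [] ∷ []) (size * suc (1 + (size * 7 + 1 + 6)) + 1)
    ((♯ ∷ rest) ∷ stacked backwards ∷ marks backwards ∷ marks backwards ∷ [] ∷ [])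
  scan-runs = while-runs (λ ds vs → rows entry vs ∷ stacked ds ∷ marks ds ∷ marks ds ∷ [] ∷ [])
    (λ _ v _ → starts v) (λ _ → refl) body [] columns
    where
    starts : ∀ v {s} → isBit (List.head (map (bit ∘ entry v) columns ++ ♯ ∷ s)) ≡ true
    starts v {s} with w , ws , eq ← nonempty v =
      trans (cong (λ ws → isBit (List.head (map (bit ∘ entry v) ws ++ ♯ ∷ s))) eq) (isBit-bit (entry v w))
    body : ∀ ds v vs → Runs scanRow (rows entry (v ∷ vs) ∷ stacked ds ∷ marks ds ∷ marks ds ∷ [] ∷ [])
      (1 + (size * 7 + 1 + 6)) (rows entry vs ∷ stacked (v ∷ ds) ∷ marks (v ∷ ds) ∷ marks (v ∷ ds) ∷ [] ∷ [])
    body ds v vs = subst₂ (λ s l → Runs scanRow ((s ++ ♯ ∷ rows entry vs) ∷ stacked ds ∷ marks ds ∷ marks ds ∷ [] ∷ [])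
                              (1 + (l * 7 + 1 + 6)) (rows entry vs ∷ stacked (v ∷ ds) ∷ marks (v ∷ ds) ∷ marks (v ∷ ds) ∷ [] ∷ []))
      (sym (List.map-∘ columns)) (List.length-map (entry v) columns) (scanRow-runs (row v))

  -- The marks on stack 2, one per column, drive the loop, so it stops exactly where the row ends on
  -- stack 1.
  copyRow-runs : ∀ v {s₀ s₁ s₃} → Runs copyRow
    (s₀ ∷ (♯ ∷ map bit (row v ʳ++ []) ++ s₁) ∷ marks backwards ∷ (bit (mark v) ∷ s₃) ∷ [] ∷ [])
    (2 + (size * 9 + 1 + (size * 4 + 1 + 1)))
    ((map (bit ∘ entry′ v) columns ++ ♯ ∷ s₀) ∷ s₁ ∷ marks backwards ∷ s₃ ∷ [] ∷ [])
  copyRow-runs v {s₀} {s₁} {s₃} =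
    exactly pop ⨟
    exactly push ⨟
    subst₂ (λ s l → Runs (whileTop 2F ∈ is-just loop copyBit)
        ((♯ ∷ s₀) ∷ (s ++ s₁) ∷ marks backwards ∷ (bit (mark v) ∷ s₃) ∷ [] ∷ []) (l * 9 + 1)
        ((map (bit ∘ entry′ v) columns ++ ♯ ∷ s₀) ∷ s₁ ∷ [] ∷ (bit (mark v) ∷ s₃) ∷ marks columns ∷ []))
      (trans (List.map-∘ backwards) (cong (map bit) (List.map-ʳ++ (entry v) columns)))
      size-backwards
      (subst (λ us → Runs (whileTop 2F ∈ is-just loop copyBit)
          ((♯ ∷ s₀) ∷ (map (bit ∘ entry v) backwards ++ s₁) ∷ marks backwards ∷ (bit (mark v) ∷ s₃) ∷ [] ∷ []) (length backwards * 9 + 1)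
          ((map (bit ∘ entry′ v) us ++ ♯ ∷ s₀) ∷ s₁ ∷ [] ∷ (bit (mark v) ∷ s₃) ∷ marks us ∷ []))
        (ʳ++-involutive columns)
        (while-runs (λ ds us → (map (bit ∘ entry′ v) ds ++ ♯ ∷ s₀) ∷ (map (bit ∘ entry v) us ++ s₁) ∷ marks us ∷ (bit (mark v) ∷ s₃) ∷ marks ds ∷ [])
          (λ _ _ _ → refl) (λ _ → refl) (λ _ u _ → copyBit-runs (entry v u) (mark v) (mark u)) [] backwards)) ⨟
    while-runs (λ ds us → (map (bit ∘ entry′ v) columns ++ ♯ ∷ s₀) ∷ s₁ ∷ marks ds ∷ (bit (mark v) ∷ s₃) ∷ marks us ∷ [])
      (λ _ _ _ → refl) (λ _ → refl) (λ _ u _ → moveBit₄₂-runs (mark u)) [] columns ⨟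
    exactly pop

  copy-runs : Runs (whileTop 3F ∈ is-just loop copyRow)
    ((♯ ∷ rest) ∷ stacked backwards ∷ marks backwards ∷ marks backwards ∷ [] ∷ [])
    (size * suc (2 + (size * 9 + 1 + (size * 4 + 1 + 1))) + 1)
    (rows entry′ columns ∷ [] ∷ marks backwards ∷ [] ∷ [] ∷ [])
  copy-runs = subst₂ (λ us l → Runs (whileTop 3F ∈ is-just loop copyRow)
      ((♯ ∷ rest) ∷ stacked backwards ∷ marks backwards ∷ marks backwards ∷ [] ∷ [])
      (l * suc (2 + (size * 9 + 1 + (size * 4 + 1 + 1))) + 1) (rows entry′ us ∷ [] ∷ marks backwards ∷ [] ∷ [] ∷ []))
    (ʳ++-involutive columns) size-backwards
    (while-runs (λ ds vs → rows entry′ ds ∷ stacked vs ∷ marks backwards ∷ marks vs ∷ [] ∷ [])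
      (λ _ _ _ → refl) (λ _ → refl) (λ _ v _ → copyRow-runs v) [] backwards)

  length-rows : length (rows entry columns) ≡ size * suc size + suc (length rest)
  length-rows = go columns
    where
    go : ∀ vs → length (rows entry vs) ≡ length vs * suc size + suc (length rest)
    go []       = refl
    go (v ∷ vs) = begin
      length (map (bit ∘ entry v) columns ++ ♯ ∷ rows entry vs)              ≡⟨ List.length-++ (map (bit ∘ entry v) columns) ⟩
      length (map (bit ∘ entry v) columns) + suc (length (rows entry vs))    ≡⟨ cong₂ _+_ (List.length-map _ columns) (cong suc (go vs)) ⟩
      size + suc (length vs * suc size + suc (length rest))                  ≡⟨ ℕ.+-suc size _ ⟩
      suc (size + (length vs * suc size + suc (length rest)))                ≡⟨ cong suc (ℕ.+-assoc size _ _) ⟨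
      suc (size + length vs * suc size + suc (length rest))                  ∎
      where open ≡-Reasoning

  -- The time is quadratic in `size`, hence linear in the input length, because the matrix alone has
  -- `size * suc size` symbols.
  coreProgram-runs : Runs coreProgram (initial (rows entry columns)) (30 * length (rows entry columns) ^ 1 + 30)
    (rows entry′ columns ∷ [] ∷ marks backwards ∷ [] ∷ [] ∷ [])
  coreProgram-runs = within time (scan-runs ⨟ copy-runs)
    where
    open +-*-Solver
    open ℕ.≤-Reasoning
    time : size * suc (1 + (size * 7 + 1 + 6)) + 1 + (size * suc (2 + (size * 9 + 1 + (size * 4 + 1 + 1))) + 1)
           ≤ 30 * length (rows entry columns) ^ 1 + 30
    time = begin
      size * suc (1 + (size * 7 + 1 + 6)) + 1 + (size * suc (2 + (size * 9 + 1 + (size * 4 + 1 + 1))) + 1)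
        -- With n for `size`, the time is 20n² + 15n + 2; the added slack completes it to the
        -- claimed bound.
        ≤⟨ ℕ.m≤m+n _ (10 * (size * size) + 15 * size + 30 * suc (length rest) + 28) ⟩
      size * suc (1 + (size * 7 + 1 + 6)) + 1 + (size * suc (2 + (size * 9 + 1 + (size * 4 + 1 + 1))) + 1)
        + (10 * (size * size) + 15 * size + 30 * suc (length rest) + 28)
        ≡⟨ solve 2 (λ n l → n :* (con 2 :+ (n :* con 7 :+ con 1 :+ con 6)) :+ con 1
               :+ (n :* (con 3 :+ (n :* con 9 :+ con 1 :+ (n :* con 4 :+ con 1 :+ con 1))) :+ con 1)
               :+ (con 10 :* (n :* n) :+ con 15 :* n :+ con 30 :* (con 1 :+ l) :+ con 28)
             := con 30 :* ((n :* (con 1 :+ n) :+ (con 1 :+ l)) :* con 1) :+ con 30) refl size (length rest) ⟩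
      30 * (size * suc size + suc (length rest)) ^ 1 + 30
        ≡⟨ cong (λ l → 30 * l ^ 1 + 30) length-rows ⟨
      30 * length (rows entry columns) ^ 1 + 30 ∎

-- From stack contents to graph encodings

trues : List Bool → ℕ
trues []       = 0
trues (b ∷ bs) = (if b then 1 else 0) + trues bs

trues-ʳ++ : ∀ bs ds → trues (bs ʳ++ ds) ≡ trues bs + trues ds
trues-ʳ++ []           ds = refl
trues-ʳ++ (false ∷ bs) ds = trues-ʳ++ bs (false ∷ ds)
trues-ʳ++ (true ∷ bs)  ds = trans (trues-ʳ++ bs (true ∷ ds)) (ℕ.+-suc _ _)

trues-toList : (p : Subset n) → trues (toList p) ≡ ∣ p ∣
trues-toList []          = refl
trues-toList (false ∷ p) = trues-toList p
trues-toList (true ∷ p)  = cong suc (trues-toList p)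

level : ℕ → Symbol
level 0 = 𝟎
level 1 = ♯
level _ = 𝟏

tally-level : ∀ bs → tally bs ≡ level (trues bs)
tally-level []           = refl
tally-level (false ∷ bs) = tally-level bs
tally-level (true ∷ bs)  = trans (cong bump (tally-level bs)) (bump-level (trues bs))
  where
  bump-level : ∀ k → bump (level k) ≡ level (suc k)
  bump-level 0             = refl
  bump-level 1             = refl
  bump-level (suc (suc _)) = refl

many-trues : ∀ bs → many bs ≡ not (does (trues bs ℕ.≤? 1))
many-trues bs rewrite tally-level bs with trues bs
... | 0           = refl
... | 1           = refl
... | suc (suc _) = refl

toList-tabulate : {A : Set} (f : Fin n → A) → toList (tabulate f) ≡ map f (allFin n)
toList-tabulate {n = zero}  f = refl
toList-tabulate {n = suc n} f = cong (f zero ∷_) (trans (toList-tabulate (f ∘ suc))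
  (trans (List.map-tabulate id (f ∘ suc)) (sym (List.map-tabulate suc f))))

allFin-nonempty : Fin n → ∃[ w ] ∃[ ws ] allFin n ≡ w ∷ ws
allFin-nonempty zero    = _ , _ , refl
allFin-nonempty (suc _) = _ , _ , refl

module _ (G : Graph n) (rest : List Symbol) where
  open Graph G
  open CoreProgram (allFin n) allFin-nonempty (λ v u → does (v ~? u)) rest

  mark-thin : ∀ v → mark v ≡ not (does (thin? G v))
  mark-thin v = trans (many-trues (row v ʳ++ [])) (cong (λ k → not (does (k ℕ.≤? 1))) (begin
    trues (row v ʳ++ [])               ≡⟨ trues-ʳ++ (row v) [] ⟩
    trues (row v) + 0                  ≡⟨ ℕ.+-identityʳ _ ⟩
    trues (row v)                      ≡⟨ cong trues (toList-tabulate (λ u → does (v ~? u))) ⟨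
    trues (toList (neighbours v))      ≡⟨ trues-toList (neighbours v) ⟩
    ∣ neighbours v ∣                   ∎))
    where open ≡-Reasoning

  -- Kept general in `H` and `a` to serve for the input `G` as well as for the output `core G`.
  encodeGraph-rows : (H : Graph n) (a : Fin n → Fin n → Bool) → (∀ v u → does (Graph._~?_ H v u) ≡ a v u) →
    encodeGraph H ++ ♯ ∷ rest ≡ rows a (allFin n)
  encodeGraph-rows H a eq = go (allFin n)
    where
    open ≡-Reasoning
    line : Fin n → List Symbol
    line v = encodeSubset (Graph.neighbours H v)
    line-row : ∀ v → line v ≡ map (bit ∘ a v) (allFin n)
    line-row v = begin
      line v                                                  ≡⟨ cong (map bit) (toList-tabulate _) ⟩
      map bit (map (λ u → does (Graph._~?_ H v u)) (allFin n)) ≡⟨ List.map-∘ (allFin n) ⟨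
      map (bit ∘ λ u → does (Graph._~?_ H v u)) (allFin n)     ≡⟨ List.map-cong (λ u → cong bit (eq v u)) (allFin n) ⟩
      map (bit ∘ a v) (allFin n)                               ∎
    go : ∀ vs → concatMap (λ v → line v ++ ♯ ∷ []) vs ++ ♯ ∷ rest ≡ rows a vs
    go []       = refl
    go (v ∷ vs) = begin
      ((line v ++ ♯ ∷ []) ++ concatMap (λ v → line v ++ ♯ ∷ []) vs) ++ ♯ ∷ rest ≡⟨ List.++-assoc (line v ++ ♯ ∷ []) _ _ ⟩
      (line v ++ ♯ ∷ []) ++ concatMap (λ v → line v ++ ♯ ∷ []) vs ++ ♯ ∷ rest   ≡⟨ List.++-assoc (line v) _ _ ⟩
      line v ++ ♯ ∷ concatMap (λ v → line v ++ ♯ ∷ []) vs ++ ♯ ∷ rest           ≡⟨ cong₂ (λ l s → l ++ ♯ ∷ s) (line-row v) (go vs) ⟩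
      rows a (v ∷ vs)                                                           ∎

  core-computation : ∃[ t ] ∃[ τ ] ( ⟨ coreProgram , initial (encodeGraph G ++ ♯ ∷ rest) ⟩⇓[ t ] τ
                                   × output τ ≡ encodeGraph (core G) ++ ♯ ∷ rest
                                   × t ≤ 30 * length (encodeGraph G ++ ♯ ∷ rest) ^ 1 + 30)
  core-computation rewrite encodeGraph-rows G _ (λ _ _ → refl) = _ , _ , proj₁ (proj₂ coreProgram-runs)
    -- The adjacency decision of `core G` unfolds to the conjunction in `entry′`, with negated
    -- thinness in place of the marks.
    , sym (encodeGraph-rows (core G) entry′ (λ v u → cong (does (v ~? u) ∧_) (sym (cong₂ _∧_ (mark-thin v) (mark-thin u)))))
    , proj₂ (proj₂ coreProgram-runs)

lemma4 : ParameterPreservingReduction POVE CPP × ParameterPreservingReduction RestrictedPOVE RestrictedCPP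
lemma4 =
  ( (λ (mkInstance G k) → mkInstance (core G) k)
  , (4 , coreProgram , 30 , 1 , λ (mkInstance G k) → core-computation G _)
  , λ (mkInstance G k) → ℕ.≤-refl , mk⇔
      (λ (S , S≤k , e) → S , S≤k , to (explosionSet⇔coPathSet G S) e)
      (λ (S , S≤k , e) → S , S≤k , from (explosionSet⇔coPathSet G S) e)) ,
  ( (λ (mkRestricted G X k) → mkRestricted (core G) X k)
  -- The same program with four work stacks: here the untouched remainder of the input holds `X` as
  -- well as `k`.
  , (4 , coreProgram , 30 , 1 , λ (mkRestricted G X k) → core-computation G _)
  , λ (mkRestricted G X k) → ℕ.≤-refl , mk⇔
      (λ (S , S⊆X , S≤k , e) → S , S⊆X , S≤k , to (explosionSet⇔coPathSet G S) e)
      (λ (S , S⊆X , S≤k , e) → S , S⊆X , S≤k , from (explosionSet⇔coPathSet G S) e))
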